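{- Let $A$ be a finite set of $n:=|A|\ge 6$ integers with $\min(A)=0$ and $\gcd(A)=1$, and let $l:=\max(A)$. Let $\mathcal{E}$ be the exceptional set of $A$ and $\mathcal{E}'$ the exceptional set of $l-A=\{l-a\colon a\in A\}$. Let $m$ be an integer with $$ m\ge\max\Big\{\,l-\tfrac32\,n+\tfrac92,\ \tfrac23\,(l-n+2)\Big\}. $$ If neither $\{0,1\}\subseteq A\subseteq\{0,1\}\cup[m+2,l]$ nor $\{l-1,l\}\subseteq A\subseteq[0,l-(m+2)]\cup\{l-1,l\}$ holds, then $$ mA=[0,ml]\setminus\big(\mathcal{E}\cup(ml-\mathcal{E}')\big). $$ If either $\{0,1\}\subseteq A\subseteq\{0,1\}\cup[m+2,l]$ or $\{l-1,l\}\subseteq A\subseteq[0,l-(m+2)]\cup\{l-1,l\}$, then this equality does not hold.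
   Context: For a finite set $A$ of integers and a positive integer $m$, $mA:=\{a_1+\dots+a_m\colon a_1,\dots,a_m\in A\}$ is the $m$-fold sumset (summands not necessarily distinct). For integers $x\le y$, $[x,y]$ denotes the set of integers $z$ with $x\le z\le y$ (empty if $x>y$). For a set $B$ of integers and an integer $c$, $c-B:=\{c-b\colon b\in B\}$. The exceptional set of a finite set $B$ of nonnegative integers with $\min(B)=0$ and $\gcd(B)=1$ is the set of all positive integers that cannot be written as a nonnegative integer linear combination of elements of $B$. -}

module Defs where

open import Data.Nat using (ℕ; zero; suc; _+_; _*_; _∸_; _≤_; _<_; _⊔_)
open import Data.Nat.GCD using (gcd)
open import Data.List using (List; foldr; map; length)
open import Data.List.Membership.Propositional using (_∈_)
open import Data.Product using (_×_)
open import Relation.Nullary using (¬_)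

gcdList : List ℕ → ℕ
gcdList = foldr gcd 0

maxList : List ℕ → ℕ
maxList = foldr _⊔_ 0

data InSumset (A : List ℕ) : ℕ → ℕ → Set where
  sum-zero : InSumset A 0 0
  sum-suc  : ∀ {m a x} → a ∈ A → InSumset A m x → InSumset A (suc m) (a + x)

data Representable (B : List ℕ) : ℕ → Set where
  rep-zero : Representable B 0
  rep-add  : ∀ {a x} → a ∈ B → Representable B x → Representable B (a + x)

Exceptional : List ℕ → ℕ → Set
Exceptional B x = (0 < x) × ¬ Representable B x

-- the set l - A (for l = max A all values are ≥ 0, so ∸ is exact)
reflectSet : ℕ → List ℕ → List ℕ
reflectSet l A = map (l ∸_) A

{-# OPTIONS --safe #-}

-- Record a k-fold sum v as the point (k , v).  The set S of these points is closed under adding (1 , 0)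
-- and (1 , l), since 0 and l lie in A, and the theorem says that a point that can be moved into S along
-- either of these two directions is already in S.  Suppose (m , x) is a maximal exception; after removing
-- the zeros, resp. the copies of l, its two neighbours become minimal points of S of sizes k₀ and k₁.
--
-- A subsum of length at least 2 of a minimal point is never congruent mod l to an element of A.  If k₀ or
-- k₁ is 1+m, counting such subsums forces all summands to be equal, and a second count, of the multiples
-- of the common summand, forces it to be 1 or l-1; this is the exceptional family.  Otherwise take the
-- partial sums of the two minimal points, cut at a first coincidence between them.  They give at least m-2
-- residue classes outside A+A mod l, and A+A covers at least 3/2 as many classes as A does unless it
-- covers all of them, which contradicts m ≥ l - 3n/2 + 9/2.
module Submission where

-- The two bounds on m serve different counts of residue classes mod l. The bound m ≥ 2(l-n+2)/3 is
-- for minimal points of size 1+m: unless all its summands are equal, such a point has at least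
-- (3(1+m)-4)/2 classes of long subsums, which do not fit beside the n-1 classes of A. The bound m ≥
-- l-3n/2+9/2 is for the pair of shorter minimal points, and it returns in the exceptional family,
-- where it says that the reflected set is dense in a short interval. The obstacle for the pair is
-- that a partial sum of one point may share its class with a partial sum of the other. A
-- coincidence cuts both points in two; it either produces a point that cannot exist or leaves, on
-- one side of the cut, a smaller pair with the property of the original one. A pair with the fewest
-- summands on the first side therefore has no coincidence left, which is the purpose of `Crossing`
-- and of the induction on its size. Coprimality prevents A+A from being trapped in a proper
-- subgroup: if A+A is small, the popular differences form a subgroup containing A, hence all of
-- ℤ/l.

open import Defs
open import Data.Nat using (ℕ; zero; suc; _+_; _*_; _∸_; _≤_; _<_; z≤n; s≤s; _≤?_; _<?_; _≟_; NonZero; >-nonZero; >-nonZero⁻¹)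
open import Data.Nat.Properties
open import Data.Nat.DivMod
  using (_/_; _%_; m≡m%n+[m/n]*n; m%n<n; m<n⇒m%n≡m; m%n%n≡m%n; n%n≡0; [m+n]%n≡m%n; [m+kn]%n≡m%n; %-distribˡ-+)
open import Data.Nat.GCD using (gcd-GCD; module Bézout)
open import Data.Nat.Induction using (<-rec)
open import Data.Nat.ListAction using (sum)
open import Data.Nat.Tactic.RingSolver using (solve)
open import Data.List using (List; []; _∷_; _++_; map; filter; length; upTo; replicate)
-- The ring solver quotes its list of variables before overloaded constructors can be resolved.
open import Data.List using () renaming ([] to □; _∷_ to _▹_)
open import Data.List.Properties using (length-++; length-map; length-upTo; length-replicate)
open import Data.List.Membership.Propositional using (_∈_; find; lose)
open import Data.List.Membership.Propositional.Properties
open import Data.List.Membership.DecPropositional _≟_ using (_∈?_)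
open import Data.List.Relation.Unary.Any using (Any; here; there; any?)
open import Data.List.Relation.Unary.All as All using (All; []; _∷_)
open import Data.List.Relation.Unary.AllPairs using ([]; _∷_)
open import Data.List.Relation.Unary.Unique.Propositional using (Unique)
open import Data.List.Relation.Unary.Unique.Propositional.Properties as Uniqueₚ using (Unique[x∷xs]⇒x∉xs)
open import Data.List.Relation.Binary.Permutation.Propositional as Perm using (_↭_; prep; swap; ↭-refl; ↭-sym; ↭-trans)
open import Data.List.Relation.Binary.Permutation.Propositional.Properties using (∈-resp-↭; ↭-length)
open import Data.Product using (∃; ∃₂; _×_; _,_; proj₁; proj₂)
open import Data.Sum using (_⊎_; inj₁; inj₂; [_,_]′)
open import Data.Empty using (⊥; ⊥-elim)
open import Function using (_∘_)
open import Function.Bundles using (_⇔_; mk⇔; Equivalence)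
open import Relation.Nullary using (¬_; Dec; yes; no; ¬?)
open import Relation.Nullary.Decidable using (map′; _×-dec_; decidable-stable)
open import Relation.Unary using (Decidable)
open import Relation.Binary.PropositionalEquality using (_≡_; _≢_; refl; sym; trans; cong; cong₂; subst; subst₂)

-- Linear arithmetic

-- To prove a ≤ b, combine hypotheses into p ≤ q so that (b - a) - (q - p) is a polynomial r with natural
-- coefficients; the identity that is left, written without subtraction, is checked by the ring solver.

infixr 5 _⊕_ _⊞_
infix 6 _⊗_

_⊕_ : ∀ {p q r s} → p ≤ q → r ≤ s → p + r ≤ q + s
_⊕_ = +-mono-≤

_⊗_ : ∀ {p q} k → p ≤ q → k * p ≤ k * q
k ⊗ h = *-monoʳ-≤ k h

scale : ∀ o {m n} → m ≤ n → m * o ≤ n * o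
scale o = *-monoˡ-≤ o

_⊞_ : ∀ {p q r s : ℕ} → p ≡ q → r ≡ s → p + r ≡ q + s
_⊞_ = cong₂ _+_

by≡ : ∀ {a b p q} → p ≡ q → a + q ≡ b + p → a ≡ b
by≡ {a} {b} {p} refl e = +-cancelʳ-≡ p a b e

by≤ : ∀ {a b p q} → p ≤ q → ∀ r → a + q + r ≡ b + p → a ≤ b
by≤ {a} {b} {p} {q} h r e =
  +-cancelʳ-≤ q a b (≤-trans (m≤m+n (a + q) r) (≤-trans (≤-reflexive e) (+-monoʳ-≤ b h)))

by⊥ : ∀ {p q} → p ≤ q → ∀ r → p ≡ suc (q + r) → ⊥
by⊥ {p} {q} h r e = <⇒≱ (≤-trans (s≤s (m≤m+n q r)) (≤-reflexive (sym e))) h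

-- Finite lists, residues and sumsets

module _ {X : Set} where

  private variable xs ys : List X

  unique-⊆⇒length≤ : Unique xs → (∀ {x} → x ∈ xs → x ∈ ys) → length xs ≤ length ys
  unique-⊆⇒length≤ {[]} _ _ = z≤n
  unique-⊆⇒length≤ {x ∷ xs} {ys} u@(_ ∷ u′) xs⊆ys with ∈-∃++ (xs⊆ys (here refl))
  ... | us , vs , refl = ≤-trans (s≤s (unique-⊆⇒length≤ u′ remove)) (≤-reflexive (sym len))
    where
    remove : ∀ {z} → z ∈ xs → z ∈ us ++ vs
    remove z∈xs with ∈-++⁻ us (xs⊆ys (there z∈xs))
    ... | inj₁ z∈us = ∈-++⁺ˡ z∈us
    ... | inj₂ (here refl) = ⊥-elim (Unique[x∷xs]⇒x∉xs u z∈xs)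
    ... | inj₂ (there z∈vs) = ∈-++⁺ʳ us z∈vs
    len : length (us ++ x ∷ vs) ≡ suc (length (us ++ vs))
    len = trans (length-++ us) (trans (+-suc _ _) (cong suc (sym (length-++ us))))

  map-unique : {Y : Set} {f : X → Y} →
    (∀ {x y} → x ∈ xs → y ∈ xs → f x ≡ f y → x ≡ y) → Unique xs → Unique (map f xs)
  map-unique {[]} _ _ = []
  map-unique {x ∷ xs} {f = f} inj (x∉ ∷ u) =
    All.tabulate distinct ∷ map-unique (λ p q → inj (there p) (there q)) u
    where
    distinct : ∀ {y} → y ∈ map f xs → f x ≢ y
    distinct y∈ eq with ∈-map⁻ f y∈
    ... | z , z∈ , refl = All.lookup x∉ z∈ (inj (here refl) (there z∈) eq)

  module _ {P : X → Set} (P? : Decidable P) where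

    length-filter-¬ : ∀ xs → length (filter P? xs) + length (filter (¬? ∘ P?) xs) ≡ length xs
    length-filter-¬ [] = refl
    length-filter-¬ (x ∷ xs) with P? x
    ... | yes _ = cong suc (length-filter-¬ xs)
    ... | no _ = trans (+-suc _ _) (cong suc (length-filter-¬ xs))

    majorities-meet : {Q : X → Set} (Q? : Decidable Q) → ∀ xs → Unique xs →
      length xs < 2 * length (filter P? xs) → length xs < 2 * length (filter Q? xs) →
      ∃ λ x → x ∈ xs × P x × Q x
    majorities-meet Q? xs u p q with any? (λ x → P? x ×-dec Q? x) xs
    ... | yes found = find found
    ... | no none = ⊥-elim (contra _ _ _ (length-filter-¬ xs) (unique-⊆⇒length≤ (Uniqueₚ.filter⁺ Q? u) Q⊆¬P) p q)
      where
      Q⊆¬P : ∀ {x} → x ∈ filter Q? xs → x ∈ filter (¬? ∘ P?) xs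
      Q⊆¬P x∈ with ∈-filter⁻ Q? x∈
      ... | x∈xs , Qx = ∈-filter⁺ (¬? ∘ P?) x∈xs λ Px → none (lose x∈xs (Px , Qx))
      contra : ∀ a b c {n} → a + b ≡ n → c ≤ b → n < 2 * a → n < 2 * c → ⊥
      contra a b c {n} e h₁ h₂ h₃ = by⊥ (2 ⊗ (≤-reflexive e) ⊕ 2 ⊗ h₁ ⊕ h₂ ⊕ h₃) 1 (solve (a ▹ b ▹ n ▹ c ▹ □))

unique-bounded : ∀ {xs n} → Unique xs → (∀ {x} → x ∈ xs → x < n) → length xs ≤ n
unique-bounded {n = n} u xs<n =
  ≤-trans (unique-⊆⇒length≤ u (∈-upTo⁺ ∘ xs<n)) (≤-reflexive (length-upTo n))

module _ (l : ℕ) .{{_ : NonZero l}} where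

  private
    quotient-gap : ∀ u w Y → u % l ≡ w % l → w / l + Y ≡ u / l → u ≡ w + Y * l
    quotient-gap u w Y = shift (u / l) (w / l) (m≡m%n+[m/n]*n u l) (m≡m%n+[m/n]*n w l)
      where
      shift : ∀ q q′ {r r′} → u ≡ r + q * l → w ≡ r′ + q′ * l → r ≡ r′ → q′ + Y ≡ q → u ≡ w + Y * l
      shift q q′ {r} e₁ e₂ refl refl = by≡ (e₁ ⊞ (sym e₂)) (solve (u ▹ r ▹ q′ ▹ Y ▹ l ▹ w ▹ □))

  -- Subtraction-free form of a congruence. The second alternative is strict, so that u ≡ w falls
  -- under the first; later case splits use its positive multiple of `l`.
  %-≡-cases : ∀ u w → u % l ≡ w % l → (∃ λ Y → u ≡ w + Y * l) ⊎ (∃ λ Y → w ≡ u + suc Y * l)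
  %-≡-cases u w eq with ≤-total (w / l) (u / l)
  ... | inj₁ le = inj₁ (u / l ∸ w / l , quotient-gap u w (u / l ∸ w / l) eq (m+[n∸m]≡n le))
  ... | inj₂ le with w / l ∸ u / l in diff
  ...   | zero = inj₁ (0 , quotient-gap u w 0 eq
                   (trans (+-identityʳ _) (≤-antisym (m∸n≡0⇒m≤n diff) le)))
  ...   | suc Y = inj₂ (Y , quotient-gap w u (suc Y) (sym eq)
                    (trans (cong (u / l +_) (sym diff)) (m+[n∸m]≡n le)))

  %-≡0 : ∀ v → v % l ≡ 0 → ∃ λ Y → v ≡ Y * l
  %-≡0 v eq = v / l , trans (m≡m%n+[m/n]*n v l) (cong (_+ (v / l) * l) eq)

  %-cong-+ : ∀ {u u′ w w′} → u % l ≡ u′ % l → w % l ≡ w′ % l → (u + w) % l ≡ (u′ + w′) % l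
  %-cong-+ {u} {u′} {w} {w′} e₁ e₂ = trans (%-distribˡ-+ u w l)
    (trans (cong₂ (λ r s → (r + s) % l) e₁ e₂) (sym (%-distribˡ-+ u′ w′ l)))

  %-injective : ∀ {u w} → u < l → w < l → u % l ≡ w % l → u ≡ w
  %-injective u<l w<l e = trans (sym (m<n⇒m%n≡m u<l)) (trans e (m<n⇒m%n≡m w<l))

  %-cancel-+ˡ : ∀ c u w → (c + u) % l ≡ (c + w) % l → u % l ≡ w % l
  %-cancel-+ˡ c u w eq with %-≡-cases (c + u) (c + w) eq
  ... | inj₁ (Y , e) = trans (cong (_% l) (+-cancelˡ-≡ c u (w + Y * l) (trans e (+-assoc c w _)))) ([m+kn]%n≡m%n w Y l)
  ... | inj₂ (Y , e) = sym (trans (cong (_% l) (+-cancelˡ-≡ c w (u + suc Y * l) (trans e (+-assoc c u _)))) ([m+kn]%n≡m%n u (suc Y) l))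

-- The points (k , v) of the iterated sumsets, and minimal points

module Sumset (A : List ℕ) (l : ℕ) .{{_ : NonZero l}} (0∈A : 0 ∈ A) (l∈A : l ∈ A) (A≤l : ∀ {a} → a ∈ A → a ≤ l) where

  S : ℕ → ℕ → Set
  S = InSumset A

  S-+ : ∀ {k v k′ v′} → S k v → S k′ v′ → S (k + k′) (v + v′)
  S-+ sum-zero s = s
  S-+ (sum-suc {a = a} {x} a∈ s) s′ = subst (S _) (sym (+-assoc a x _)) (sum-suc a∈ (S-+ s s′))

  S-two : ∀ {a b} → a ∈ A → b ∈ A → S 2 (a + b)
  S-two {a} {b} a∈ b∈ = subst (S 2) (cong (a +_) (+-identityʳ b)) (sum-suc a∈ (sum-suc b∈ sum-zero))

  S-one : ∀ {a} → a ∈ A → S 1 a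
  S-one {a} a∈ = subst (S 1) (+-identityʳ a) (sum-suc a∈ sum-zero)

  S-zeros : ∀ X {k v} → S k v → S (X + k) v
  S-zeros zero s = s
  S-zeros (suc X) s = sum-suc 0∈A (S-zeros X s)

  S-ls : ∀ Y {k v} → S k v → S (Y + k) (Y * l + v)
  S-ls zero s = s
  S-ls (suc Y) s = subst (S _) (sym (+-assoc l (Y * l) _)) (sum-suc l∈A (S-ls Y s))

  S-up : ∀ {k v m x} Y → S k v → v + Y * l ≡ x → k + Y ≤ m → S m x
  S-up {k} {v} {m} {x} Y s e h =
    subst₂ S (trans (cong (m ∸ (k + Y) +_) (+-comm Y k)) (m∸n+n≡m h)) (trans (+-comm _ v) e)
      (S-zeros (m ∸ (k + Y)) (S-ls Y s))

  S-≤ : ∀ {k v} → S k v → v ≤ k * l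
  S-≤ sum-zero = z≤n
  S-≤ (sum-suc a∈ s) = +-mono-≤ (A≤l a∈) (S-≤ s)

  -- Decidability permits the search for a maximal exception, and it absorbs the double negations
  -- that come with `Exceptional`.
  S? : ∀ k v → Dec (S k v)
  S? zero zero = yes sum-zero
  S? zero (suc v) = no λ ()
  S? (suc k) v = map′ to from (any? (λ a → (a ≤? v) ×-dec S? k (v ∸ a)) A)
    where
    to : Any (λ a → a ≤ v × S k (v ∸ a)) A → S (suc k) v
    to found with find found
    ... | a , a∈ , a≤v , s = subst (S (suc k)) (m+[n∸m]≡n a≤v) (sum-suc a∈ s)
    from : S (suc k) v → Any (λ a → a ≤ v × S k (v ∸ a)) A
    from (sum-suc {a = a} {x} a∈ s) = lose a∈ (m≤m+n a x , subst (S k) (sym (m+n∸m≡n a x)) s)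

  S⇒Rep : ∀ {k v} → S k v → Representable A v
  S⇒Rep sum-zero = rep-zero
  S⇒Rep (sum-suc a∈ s) = rep-add a∈ (S⇒Rep s)

  Rep⇒S : ∀ {v} → Representable A v → ∃ λ k → S k v
  Rep⇒S rep-zero = 0 , sum-zero
  Rep⇒S (rep-add a∈ r) = _ , sum-suc a∈ (proj₂ (Rep⇒S r))

  S⇒list : ∀ {k v} → S k v → ∃ λ es → All (_∈ A) es × length es ≡ k × sum es ≡ v
  S⇒list sum-zero = [] , [] , refl , refl
  S⇒list (sum-suc a∈ s) with S⇒list s
  ... | es , es∈ , refl , refl = _ , a∈ ∷ es∈ , refl , refl

  list⇒S : ∀ {es} → All (_∈ A) es → S (length es) (sum es)
  list⇒S [] = sum-zero
  list⇒S (a∈ ∷ es∈) = sum-suc a∈ (list⇒S es∈)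

  -- (K , V) does not arise from another point of S by adding zeros and Y copies of l.
  Minimal : ℕ → ℕ → Set
  Minimal K V = ∀ {k v} Y → S k v → v + Y * l ≡ V → k + Y ≤ K → k < K → ⊥

  -- A subsum kept together with its complement: the exchange arguments below replace `part` and
  -- leave `rest` alone.
  record Divides (k v K V : ℕ) : Set where
    constructor divides
    field
      {ck cv} : ℕ
      part : S k v
      rest : S ck cv
      k+ck : k + ck ≡ K
      v+cv : v + cv ≡ V

  Divides-refl : ∀ {k v} → S k v → Divides k v k v
  Divides-refl s = divides s sum-zero (+-identityʳ _) (+-identityʳ _)

  Divides-trans : ∀ {k v k′ v′ K V} → Divides k v k′ v′ → Divides k′ v′ K V → Divides k v K V
  Divides-trans {k} {v} (divides {ck} {cv} s c refl refl) (divides _ c′ refl refl) =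
    divides s (S-+ c c′) (sym (+-assoc k ck _)) (sym (+-assoc v cv _))

  Divides-+ʳ : ∀ {k v K V k′ v′} → Divides k v K V → S k′ v′ → Divides k v (k′ + K) (v′ + V)
  Divides-+ʳ {k} {v} {k′ = k′} {v′} (divides {ck} {cv} s c refl refl) s′ =
    divides s (S-+ s′ c) (solve (k ▹ k′ ▹ ck ▹ □)) (solve (v ▹ v′ ▹ cv ▹ □))

  module _ {K V} (min : Minimal K V) where

    -- A shortening of the part, added to the complement, would shorten the whole.
    Minimal-part : ∀ {k v} → Divides k v K V → Minimal k v
    Minimal-part {k} (divides {ck} {cv} s c refl refl) {k′} {v′} Y s′ refl h₁ h₂ =
      min {k′ + ck} {v′ + cv} Y (S-+ s′ c)
        (solve (v′ ▹ cv ▹ Y ▹ l ▹ □))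
        (by≤ h₁ 0 (solve (k′ ▹ Y ▹ k ▹ ck ▹ □)))
        (by≤ h₂ 0 (solve (k′ ▹ k ▹ ck ▹ □)))

  module _ {k v} (min : Minimal k v) (s : S k v) (1≤k : 1 ≤ k) where

    -- For Y ≤ k the point would consist of Y copies of `l` and of zeros, so it would arise from (0
    -- , 0); a larger Y exceeds the maximal value k*l.
    Minimal⇒zero-free : ∀ Y → v ≢ Y * l
    Minimal⇒zero-free Y refl with Y ≤? k
    ... | yes Y≤k = min Y sum-zero refl Y≤k 1≤k
    ... | no Y≰k = by-size (≰⇒> Y≰k) (S-≤ s)
      where
      by-size : suc k ≤ Y → Y * l ≤ k * l → ⊥
      by-size h₁ h₂ = <⇒≱ h₁ (*-cancelʳ-≤ Y k l h₂)

    Minimal⇒0< : 0 < v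
    Minimal⇒0< = n≢0⇒n>0 (Minimal⇒zero-free 0)

    Minimal⇒<k*l : v < k * l
    Minimal⇒<k*l = ≤∧≢⇒< (S-≤ s) (Minimal⇒zero-free k)

-- The 3/2 bound for A+A mod l

module _ {X Y : Set} {P : X → Y → Set} (P? : ∀ x y → Dec (P x y)) where

  private
    columns : List X → List Y → ℕ
    columns xs ys = sum (map (λ y → length (filter (λ x → P? x y) xs)) ys)

    count : Y → List X → ℕ
    count y xs = length (filter (λ x → P? x y) xs)

    swap-summands : ∀ a b c d → b ≡ c + d → a + b ≡ c + (a + d)
    swap-summands a b c d e = by≡ e (solve (b ▹ c ▹ d ▹ a ▹ □))

    columns-∷ : ∀ x xs ys → columns (x ∷ xs) ys ≡ length (filter (P? x) ys) + columns xs ys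
    columns-∷ x xs [] = refl
    columns-∷ x xs (y ∷ ys) with P? x y
    ... | yes _ = cong suc (swap-summands (count y xs) (columns (x ∷ xs) ys) (length (filter (P? x) ys)) (columns xs ys) (columns-∷ x xs ys))
    ... | no _ = swap-summands (count y xs) (columns (x ∷ xs) ys) (length (filter (P? x) ys)) (columns xs ys) (columns-∷ x xs ys)

    columns-[] : ∀ ys → columns [] ys ≡ 0
    columns-[] [] = refl
    columns-[] (_ ∷ ys) = columns-[] ys

  double-counting : ∀ xs ys →
    sum (map (λ x → length (filter (P? x) ys)) xs) ≡ sum (map (λ y → length (filter (λ x → P? x y) xs)) ys)
  double-counting [] ys = sym (columns-[] ys)
  double-counting (x ∷ xs) ys = trans (cong (length (filter (P? x) ys) +_) (double-counting xs ys)) (sym (columns-∷ x xs ys))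

module _ {X : Set} (f : X → ℕ) where

  sum-map-≤ : ∀ c xs → (∀ {x} → x ∈ xs → f x ≤ c) → sum (map f xs) ≤ length xs * c
  sum-map-≤ c [] h = z≤n
  sum-map-≤ c (x ∷ xs) h = +-mono-≤ (h (here refl)) (sum-map-≤ c xs (h ∘ there))

  sum-map-≥ : ∀ {c} xs → (∀ x → c ≤ 2 * f x) → length xs * c ≤ 2 * sum (map f xs)
  sum-map-≥ [] h = z≤n
  sum-map-≥ (x ∷ xs) h = ≤-trans (+-mono-≤ (h x) (sum-map-≥ xs h)) (≤-reflexive (sym (*-distribˡ-+ 2 (f x) (sum (map f xs)))))

-- Bézout's identity in ℕ reads d + y*w = x*u or the same with u and w exchanged, so closure under
-- cancellation does the work of subtraction.
gcd-closed : (Q : ℕ → Set) → Q 0 → (∀ {u w} → Q u → Q w → Q (u + w)) → (∀ {u w} → Q u → Q (u + w) → Q w) →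
  ∀ {A} → (∀ {a} → a ∈ A → Q a) → Q (gcdList A)
gcd-closed Q Q0 Q+ Q- {[]} QA = Q0
gcd-closed Q Q0 Q+ Q- {a ∷ A} QA = closed (Bézout.identity (gcd-GCD a (gcdList A)))
  where
  multiple : ∀ k {u} → Q u → Q (k * u)
  multiple zero q = Q0
  multiple (suc k) q = Q+ q (multiple k q)
  Qa = QA (here refl)
  Qg = gcd-closed Q Q0 Q+ Q- {A} (QA ∘ there)
  closed : ∀ {d} → Bézout.Identity d a (gcdList A) → Q d
  closed {d} (Bézout.+- x y eq) =
    Q- (multiple y Qg) (subst Q (trans (sym eq) (+-comm d (y * gcdList A))) (multiple x Qa))
  closed {d} (Bézout.-+ x y eq) =
    Q- (multiple x Qa) (subst Q (trans (sym eq) (+-comm d (x * a))) (multiple y Qg))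

module Doubling (A : List ℕ) (gcd≡1 : gcdList A ≡ 1) (l : ℕ) .{{_ : NonZero l}}
  (B : List ℕ) (uB : Unique B) (B<l : ∀ {b} → b ∈ B → b < l) (0∈B : 0 ∈ B)
  (A⊆B : ∀ {a} → a ∈ A → a % l ∈ B) where

  private
    n = length B

  TwoB : ℕ → Set
  TwoB r = Any (λ a → Any (λ b → (a + b) % l ≡ r) B) B

  twoB? : Decidable TwoB
  twoB? r = any? (λ a → any? (λ b → (a + b) % l ≟ r) B) B

  twoB : ∀ {a b} → a ∈ B → b ∈ B → TwoB ((a + b) % l)
  twoB a∈ b∈ = lose a∈ (lose b∈ refl)

  D : List ℕ
  D = filter twoB? (upTo l)

  ∈D : ∀ {a b} → a ∈ B → b ∈ B → (a + b) % l ∈ D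
  ∈D {a} {b} a∈ b∈ = ∈-filter⁺ twoB? (∈-upTo⁺ (m%n<n (a + b) l)) (twoB a∈ b∈)

  translate-unique : ∀ c {xs} → Unique xs → (∀ {x} → x ∈ xs → x < l) → Unique (map (λ b → (c + b) % l) xs)
  translate-unique c u xs<l = map-unique (λ x∈ y∈ e → %-injective l (xs<l x∈) (xs<l y∈) (%-cancel-+ˡ l c _ _ e)) u

  Meets : ℕ → ℕ → Set
  Meets t b = (b + t) % l ∈ B

  meets? : ∀ t b → Dec (Meets t b)
  meets? t b = (b + t) % l ∈? B

  -- Under the hypothesis `small` below, these t form a subgroup of ℤ/l.
  Popular : ℕ → Set
  Popular t = n < 2 * length (filter (meets? t) B)

  module _ (small : 2 * length D < 3 * n) where

    -- The translates b₁ + B and b₂ + B both lie in B + B, which has fewer than 3n/2 classes, so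
    -- they overlap in more than n/2. An overlap b₁ + b ≡ b₂ + b′ says that b + t ≡ b′.
    difference-popular : ∀ {b₁ b₂ t} → b₁ ∈ B → b₂ ∈ B → b₁ % l ≡ (b₂ + t) % l → Popular t
    difference-popular {b₁} {b₂} {t} b₁∈ b₂∈ e =
      count (length-filter-¬ (meets? t) B) two-translates small
      where
      miss = filter (¬? ∘ meets? t) B
      disjoint : ∀ {z} → z ∈ map (λ b → (b₁ + b) % l) miss × z ∈ map (λ b → (b₂ + b) % l) B → ⊥
      disjoint (z∈ , z∈′) with ∈-map⁻ _ z∈ | ∈-map⁻ _ z∈′
      ... | b , b∈ , refl | b′ , b′∈ , e′ = proj₂ (∈-filter⁻ (¬? ∘ meets? t) {xs = B} b∈)
        (subst (_∈ B) (trans (sym (m<n⇒m%n≡m (B<l b′∈))) (sym eq)) b′∈)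
        where
        eq : (b + t) % l ≡ b′ % l
        eq = %-cancel-+ˡ l b₂ _ _ (trans (cong (_% l) (trans (cong (b₂ +_) (+-comm b t)) (sym (+-assoc b₂ t b))))
               (trans (%-cong-+ l {b₂ + t} {b₁} (sym e) refl) e′))
      two-translates : length miss + n ≤ length D
      two-translates = ≤-trans (≤-reflexive (sym (trans (length-++ (map _ miss)) (cong₂ _+_ (length-map _ miss) (length-map _ B)))))
        (unique-⊆⇒length≤ (Uniqueₚ.++⁺
            (translate-unique b₁ (Uniqueₚ.filter⁺ _ uB) (B<l ∘ proj₁ ∘ ∈-filter⁻ (¬? ∘ meets? t)))
            (translate-unique b₂ uB B<l) disjoint)
          ([ left , right ]′ ∘ ∈-++⁻ (map _ miss)))
        where
        left : ∀ {z} → z ∈ map (λ b → (b₁ + b) % l) miss → z ∈ D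
        left z∈ with ∈-map⁻ _ z∈
        ... | b , b∈ , refl = ∈D b₁∈ (proj₁ (∈-filter⁻ (¬? ∘ meets? t) b∈))
        right : ∀ {z} → z ∈ map (λ b → (b₂ + b) % l) B → z ∈ D
        right z∈ with ∈-map⁻ _ z∈
        ... | b , b∈ , refl = ∈D b₂∈ b∈
      count : ∀ {r m d n} → r + m ≡ n → m + n ≤ d → 2 * d < 3 * n → n < 2 * r
      count {r} {m} {d} {n} h₁ h₂ h₃ = by≤ (2 ⊗ (≤-reflexive (sym h₁)) ⊕ 2 ⊗ h₂ ⊕ h₃) 0 (solve (r ▹ m ▹ n ▹ d ▹ □))

    -- Two majorities of `B` share some b. Then b + u and b + w both have their class in `B`, and
    -- they differ by t, so t is itself a difference of two elements.
    popular-cancel : ∀ {u w t} → Popular u → Popular w → (u + t) % l ≡ w % l → Popular t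
    popular-cancel {u} {w} {t} pu pw e with majorities-meet (meets? u) (meets? w) B uB pu pw
    ... | b , b∈ , mu , mw = difference-popular mw mu
      (trans (m%n%n≡m%n (b + w) l) (sym (trans (%-cong-+ l {(b + u) % l} {b + u} (m%n%n≡m%n (b + u) l) refl)
        (trans (cong (_% l) (+-assoc b u t)) (%-cong-+ l {b} refl e)))))

    popular-0 : Popular 0
    popular-0 = difference-popular 0∈B 0∈B refl

    popular-+ : ∀ {u w} → Popular u → Popular w → Popular (u + w)
    popular-+ {u} {w} pu pw = popular-cancel { -u } pu⁻ pw
      (trans (cong (_% l) rearrange) ([m+kn]%n≡m%n w u l))
      where
      -- A natural number congruent to the negative of u; it is popular by cancellation, and
      -- cancelling it from w gives u + w.
      -u = u * (l ∸ 1)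
      u+-u : u + -u ≡ u * l
      u+-u = trans (sym (*-suc u (l ∸ 1))) (cong (u *_) (suc-pred l))
      pu⁻ : Popular -u
      pu⁻ = popular-cancel {u} {0} pu popular-0 (trans (cong (_% l) u+-u) ([m+kn]%n≡m%n 0 u l))
      rearrange : -u + (u + w) ≡ w + u * l
      rearrange = trans (sym (+-assoc -u u w)) (trans (+-comm (-u + u) w) (cong (w +_) (trans (+-comm -u u) u+-u)))

    all-popular : ∀ t → Popular t
    all-popular zero = popular-0
    all-popular (suc t) = popular-+ popular-1 (all-popular t)
      where
      popular-A : ∀ {a} → a ∈ A → Popular a
      popular-A {a} a∈ = difference-popular (A⊆B a∈) 0∈B (m%n%n≡m%n a l)
      popular-1 : Popular 1
      popular-1 = subst Popular gcd≡1 (gcd-closed Popular popular-0 popular-+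
        (λ {u} {w} pu pu+w → popular-cancel {u} {u + w} pu pu+w refl) popular-A)

    -- Averaging the popularity over all translates.
    l<2n : l < 2 * n
    l<2n = ≰⇒> λ 2n≤l → count 2n≤l (∈-length 0∈B)
      (≤-trans (≤-reflexive (cong (_* suc n) (sym (length-upTo l))))
        (≤-trans (sum-map-≥ (λ t → length (filter (meets? t) B)) (upTo l) all-popular)
          (*-monoʳ-≤ 2 (≤-trans (≤-reflexive (double-counting meets? (upTo l) B))
            (sum-map-≤ (λ b → length (filter (λ t → meets? t b) (upTo l))) n B (λ {b} _ → hits b))))))
      where
      hits : ∀ b → length (filter (λ t → meets? t b) (upTo l)) ≤ n
      hits b = ≤-trans (≤-reflexive (sym (length-map (λ t → (b + t) % l) (filter (λ t → meets? t b) (upTo l)))))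
        (unique-⊆⇒length≤ (translate-unique b (Uniqueₚ.filter⁺ _ (Uniqueₚ.upTo⁺ l))
            (∈-upTo⁻ ∘ proj₁ ∘ ∈-filter⁻ (λ t → meets? t b))) into)
        where
        into : ∀ {z} → z ∈ map (λ t → (b + t) % l) (filter (λ t → meets? t b) (upTo l)) → z ∈ B
        into z∈ with ∈-map⁻ _ z∈
        ... | t , t∈ , refl = proj₂ (∈-filter⁻ (λ t → meets? t b) {xs = upTo l} t∈)
      count : 2 * n ≤ l → 0 < n → l * suc n ≤ 2 * (n * n) → ⊥
      count h₁ h₂ h₃ = contra (*-monoˡ-≤ (suc n) h₁) h₂ h₃
        where
        contra : ∀ {n} → 2 * n * suc n ≤ l * suc n → 0 < n → l * suc n ≤ 2 * (n * n) → ⊥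
        contra {n} h₁ h₂ h₃ = by⊥ (h₁ ⊕ 2 ⊗ h₂ ⊕ h₃) 1 (solve (n ▹ l ▹ □))

  -- The sets B and r - B are disjoint mod `l`, since a common class would write r as a sum of two
  -- elements of `B`.
  missing⇒2n≤l : ∀ {r} → r < l → ¬ TwoB r → 2 * n ≤ l
  missing⇒2n≤l {r} r<l r∉ = ≤-trans (≤-reflexive size)
    (unique-bounded (Uniqueₚ.++⁺ uB (map-unique (λ {x} {y} x∈ y∈ → reflect-injective {x} {y} x∈ y∈) uB) disjoint)
      ([ B<l , below ]′ ∘ ∈-++⁻ B))
    where
    reflect : ℕ → ℕ
    reflect b = (r + (l ∸ b)) % l
    size : 2 * n ≡ length (B ++ map reflect B)
    size = trans (cong (n +_) (+-identityʳ n)) (sym (trans (length-++ B) (cong (n +_) (length-map reflect B))))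
    +reflect : ∀ c {b} → b ∈ B → (c + b + (r + (l ∸ b))) % l ≡ (c + r) % l
    +reflect c {b} b∈ =
      trans (cong (_% l) (regroup c b r (l ∸ b))) (trans (cong (λ s → (c + r + s) % l) (m+[n∸m]≡n (<⇒≤ (B<l b∈)))) ([m+n]%n≡m%n (c + r) l))
      where
      regroup : ∀ c b r s → c + b + (r + s) ≡ c + r + (b + s)
      regroup c b r s = solve (c ▹ b ▹ r ▹ s ▹ □)
    reflect-injective : ∀ {x y} → x ∈ B → y ∈ B → reflect x ≡ reflect y → x ≡ y
    reflect-injective {x} {y} x∈ y∈ e = %-injective l (B<l x∈) (B<l y∈) (%-cancel-+ˡ l r x y
      (trans (cong (_% l) (+-comm r x)) (trans (sym (+reflect x y∈))
        (trans (%-cong-+ l {x + y} {y + x} (cong (_% l) (+-comm x y)) (sym e)) (trans (+reflect y x∈) (cong (_% l) (+-comm y r)))))))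
    disjoint : ∀ {z} → z ∈ B × z ∈ map reflect B → ⊥
    disjoint (z∈ , z∈′) with ∈-map⁻ reflect z∈′
    ... | b , b∈ , refl = r∉ (lose b∈ (lose z∈
      (trans (%-cong-+ l {b} {b} refl (m%n%n≡m%n (r + (l ∸ b)) l)) (trans (+reflect 0 b∈) (m<n⇒m%n≡m r<l)))))
    below : ∀ {z} → z ∈ map reflect B → z < l
    below z∈ with ∈-map⁻ reflect z∈
    ... | b , _ , refl = m%n<n (r + (l ∸ b)) l

  -- A doubling below 3/2 would make every residue popular and force l < 2n, whereas a missing class
  -- needs 2n ≤ l.
  missing⇒3n≤2∣D∣ : ∀ {r} → r < l → ¬ TwoB r → 3 * n ≤ 2 * length D
  missing⇒3n≤2∣D∣ r<l r∉ = ≮⇒≥ λ small → <⇒≱ (l<2n small) (missing⇒2n≤l r<l r∉)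

-- Subsums of a non-constant sequence

+-left-comm : ∀ x y z → x + (y + z) ≡ y + (x + z)
+-left-comm x y z = solve (x ▹ y ▹ z ▹ □)

-- Positions are selected rather than values, so repeated entries cause no trouble. Size and sum of
-- both sides are recorded, which makes passing to the complement a mere swap.
data Part : List ℕ → (k v k′ v′ : ℕ) → Set where
  done : Part [] 0 0 0 0
  take : ∀ {e es k v k′ v′} → Part es k v k′ v′ → Part (e ∷ es) (suc k) (e + v) k′ v′
  skip : ∀ {e es k v k′ v′} → Part es k v k′ v′ → Part (e ∷ es) k v (suc k′) (e + v′)

Part-swap : ∀ {es k v k′ v′} → Part es k v k′ v′ → Part es k′ v′ k v
Part-swap done = done
Part-swap (take p) = skip (Part-swap p)
Part-swap (skip p) = take (Part-swap p)

Part-sum : ∀ {es k v k′ v′} → Part es k v k′ v′ → v + v′ ≡ sum es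
Part-sum done = refl
Part-sum (take {e} {v = v} {v′ = v′} p) = trans (+-assoc e v v′) (cong (e +_) (Part-sum p))
Part-sum (skip {e} {v = v} {v′ = v′} p) = regroup (Part-sum p)
  where
  regroup : ∀ {s} → v + v′ ≡ s → v + (e + v′) ≡ e + s
  regroup {s} h = by≡ h (solve (v ▹ v′ ▹ s ▹ e ▹ □))

Part-all : ∀ es → Part es (length es) (sum es) 0 0
Part-all [] = done
Part-all (e ∷ es) = take (Part-all es)

Part-none : ∀ es → Part es 0 0 (length es) (sum es)
Part-none es = Part-swap (Part-all es)

Part-replicate : ∀ g {t p} → t ≤ p → ∃₂ λ k′ v′ → Part (replicate p g) t (t * g) k′ v′
Part-replicate g {p = p} z≤n = _ , _ , Part-none (replicate p g)
Part-replicate g (s≤s t≤p) with Part-replicate g t≤p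
... | _ , _ , part = _ , _ , take part

Part-↭ : ∀ {es es′ k v k′ v′} → es ↭ es′ → Part es k v k′ v′ → Part es′ k v k′ v′
Part-↭ Perm.refl p = p
Part-↭ (prep _ π) (take p) = take (Part-↭ π p)
Part-↭ (prep _ π) (skip p) = skip (Part-↭ π p)
Part-↭ (swap x y π) (take (take {v = v} p)) rewrite +-left-comm x y v = take (take (Part-↭ π p))
Part-↭ (swap x y π) (take (skip p)) = skip (take (Part-↭ π p))
Part-↭ (swap x y π) (skip (take p)) = take (skip (Part-↭ π p))
Part-↭ (swap x y π) (skip (skip {v′ = v′} p)) rewrite +-left-comm x y v′ = skip (skip (Part-↭ π p))
Part-↭ (Perm.trans π ρ) p = Part-↭ ρ (Part-↭ π p)

-- Normal form of a non-constant sequence up to order. Peeling off a pair of distinct entries will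
-- gain three subsums for two entries; `spike` and `triple` are the cores from which no such pair
-- can be removed without leaving a constant or empty rest.
data Shape : List ℕ → Set where
  spike : ∀ {h g} p → h ≢ g → Shape (h ∷ replicate (suc p) g)
  triple : ∀ {f g h} → f ≢ g → f ≢ h → g ≢ h → Shape (f ∷ g ∷ h ∷ [])
  pair : ∀ {x y es} → x ≢ y → Shape es → Shape (x ∷ y ∷ es)

Shape-nonempty : ∀ {es} → Shape es → 1 ≤ length es
Shape-nonempty (spike _ _) = s≤s z≤n
Shape-nonempty (triple _ _ _) = s≤s z≤n
Shape-nonempty (pair _ _) = s≤s z≤n

insert : ∀ z {es} → Shape es → ∃ λ es′ → z ∷ es ↭ es′ × Shape es′
insert z (spike {h} {g} p h≢g) with z ≟ g
... | yes refl = _ , swap z h ↭-refl , spike (suc p) h≢g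
... | no z≢g with p
...   | suc p′ = _ , prep z (swap h g ↭-refl) , pair z≢g (spike p′ h≢g)
...   | zero with z ≟ h
-- With a single g the roles are exchanged: the equal entries z and h become the constant block, and
-- g becomes the odd one out.
...     | yes refl = _ , ↭-trans (prep z (swap h g ↭-refl)) (swap z g ↭-refl) , spike 1 (h≢g ∘ sym)
...     | no z≢h = _ , ↭-refl , triple z≢h z≢g h≢g
insert z (triple {f} {g} {h} f≢g f≢h g≢h) with z ≟ f
... | yes refl = _ , prep z (↭-trans (swap f g ↭-refl) (prep g (swap f h ↭-refl))) , pair f≢g (spike 0 (f≢h ∘ sym))
... | no z≢f = _ , ↭-refl , pair z≢f (spike 0 g≢h)
insert z (pair {x} {y} x≢y s) with insert z s
... | es′ , π , s′ = _ , ↭-trans (swap z x ↭-refl) (prep x (↭-trans (swap z y ↭-refl) (prep y π))) , pair x≢y s′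

constant-or-shape : ∀ es → (∃ λ g → es ≡ replicate (length es) g) ⊎ (∃ λ es′ → es ↭ es′ × Shape es′)
constant-or-shape [] = inj₁ (0 , refl)
constant-or-shape (z ∷ es) with constant-or-shape es
... | inj₂ (es′ , π , s) = let es″ , ρ , s′ = insert z s in inj₂ (es″ , ↭-trans (prep z π) ρ , s′)
constant-or-shape (z ∷ []) | inj₁ _ = inj₁ (z , refl)
constant-or-shape (z ∷ e ∷ es) | inj₁ (g , eq) with z ≟ g
... | yes refl = inj₁ (z , cong (z ∷_) eq)
... | no z≢g = inj₂ (_ , ↭-refl , subst (λ xs → Shape (z ∷ xs)) (sym eq) (spike (length es) z≢g))

module Growth (l : ℕ) .{{_ : NonZero l}} where

  -- What minimality of a point leaves visible modulo `l`; in this form it is inherited by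
  -- subsequences, so the count can proceed by induction on the sequence.
  record Free (es : List ℕ) : Set where
    field
      bounded : ∀ {g} → g ∈ es → g < l
      zero-free : ∀ {k v k′ v′} → Part es k v k′ v′ → 1 ≤ k → v % l ≢ 0
      atom-free : ∀ {k v k′ v′ g} → Part es k v k′ v′ → 2 ≤ k → g ∈ es → v % l ≢ g % l

  Free-↭ : ∀ {es es′} → es ↭ es′ → Free es → Free es′
  Free-↭ π F = record
    { bounded = λ g∈ → bounded (∈-resp-↭ (↭-sym π) g∈)
    ; zero-free = λ p → zero-free (Part-↭ (↭-sym π) p)
    ; atom-free = λ p 2≤k g∈ → atom-free (Part-↭ (↭-sym π) p) 2≤k (∈-resp-↭ (↭-sym π) g∈) }
    where open Free F

  Free-tail : ∀ {e es} → Free (e ∷ es) → Free es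
  Free-tail F = record
    { bounded = λ g∈ → bounded (there g∈)
    ; zero-free = λ p → zero-free (skip p)
    ; atom-free = λ p 2≤k g∈ → atom-free (skip p) 2≤k (there g∈) }
    where open Free F

  LongSum : List ℕ → ℕ → Set
  LongSum es r = ∃₂ λ k v → ∃₂ λ k′ v′ → Part es k v k′ v′ × 2 ≤ k × r ≡ v % l

  -- The constant 4 comes from two distinct entries, which have a single subsum of length 2. Every
  -- further pair adds 6 to both sides of `count`.
  record ManySums (es : List ℕ) : Set where
    field
      sums : List ℕ
      unique : Unique sums
      long : All (LongSum es) sums
      count : 3 * length es ≤ 2 * length sums + 4

  ManySums-↭ : ∀ {es es′} → es ↭ es′ → ManySums es → ManySums es′
  ManySums-↭ π M = record
    { sums = sums
    ; unique = unique
    ; long = All.map (λ (_ , _ , _ , _ , p , h) → _ , _ , _ , _ , Part-↭ π p , h) long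
    ; count = subst (λ n → 3 * n ≤ 2 * length sums + 4) (↭-length π) count }
    where open ManySums M

  private
    cancel : ∀ c u w → (c + u) % l ≡ (c + w) % l → u % l ≡ w % l
    cancel = %-cancel-+ˡ l

    %-≢ : ∀ {u w} → u < l → w < l → u ≢ w → u % l ≢ w % l
    %-≢ u<l w<l u≢w e = u≢w (%-injective l u<l w<l e)

    cancel-0 : ∀ c u → (c + u) % l ≡ c % l → u % l ≡ 0
    cancel-0 c u e = trans (cancel c u 0 (trans e (cong (_% l) (sym (+-identityʳ c))))) (m<n⇒m%n≡m (m<n⇒0<n (m%n<n 0 l)))

  module SpikeSums (h g P : ℕ)
    (tg≢0 : ∀ {t} → 1 ≤ t → t ≤ P → (t * g) % l ≢ 0)
    (h+tg≢0 : ∀ {t} → t ≤ P → (h + t * g) % l ≢ 0)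
    (tg≢h : ∀ {t} → 1 ≤ t → t ≤ P → (t * g) % l ≢ h % l) where

    data SpikeSum (p : ℕ) : ℕ → Set where
      without : ∀ {t} → 2 ≤ t → t ≤ p → SpikeSum p ((t * g) % l)
      with-h : ∀ {t} → 1 ≤ t → t ≤ p → SpikeSum p ((h + t * g) % l)

    SpikeSum-suc : ∀ {p r} → SpikeSum p r → SpikeSum (suc p) r
    SpikeSum-suc (without h₁ h₂) = without h₁ (m≤n⇒m≤1+n h₂)
    SpikeSum-suc (with-h h₁ h₂) = with-h h₁ (m≤n⇒m≤1+n h₂)

    private
      split : ∀ {t p} → t ≤ p → suc p * g ≡ t * g + (suc p ∸ t) * g
      split {t} {p} t≤p = trans (cong (_* g) (sym (m+[n∸m]≡n (m≤n⇒m≤1+n t≤p)))) (*-distribʳ-+ g t (suc p ∸ t))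

      gap≥1 : ∀ {t p} → t ≤ p → 1 ≤ suc p ∸ t
      gap≥1 t≤p = m<n⇒0<n∸m (s≤s t≤p)

      gap≤P : ∀ t {p} → p < P → suc p ∸ t ≤ P
      gap≤P t {p} p<P = ≤-trans (m∸n≤m (suc p) t) p<P

    -- Cancelling t*g turns a repetition into a smaller positive multiple of g being congruent to 0
    -- or to h.
    multiple-new : ∀ {p r} → p < P → SpikeSum p r → (suc p * g) % l ≢ r
    multiple-new {p} p<P (without {t} h₁ h₂) e =
      tg≢0 (gap≥1 h₂) (gap≤P t p<P) (cancel-0 (t * g) _ (trans (cong (_% l) (sym (split h₂))) e))
    multiple-new {p} p<P (with-h {t} h₁ h₂) e =
      tg≢h (gap≥1 h₂) (gap≤P t p<P) (cancel (t * g) _ _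
        (trans (cong (_% l) (sym (split h₂))) (trans e (cong (_% l) (+-comm h (t * g))))))

    shifted-new : ∀ {p r} → p < P → SpikeSum p r → (h + suc p * g) % l ≢ r
    shifted-new {p} p<P (without {t} h₁ h₂) e =
      h+tg≢0 {suc p ∸ t} (gap≤P t p<P) (cancel-0 (t * g) _ (trans (cong (_% l) regroup) e))
      where
      regroup : t * g + (h + (suc p ∸ t) * g) ≡ h + suc p * g
      regroup = trans (sym (+-assoc (t * g) h _)) (trans (cong (_+ (suc p ∸ t) * g) (+-comm (t * g) h))
                  (trans (+-assoc h (t * g) _) (cong (h +_) (sym (split h₂)))))
    shifted-new {p} p<P (with-h {t} h₁ h₂) e =
      tg≢0 (gap≥1 h₂) (gap≤P t p<P) (cancel-0 (t * g) _ (trans (cong (_% l) (sym (split h₂))) (cancel h _ _ e)))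

    spike-sums : ∀ p → p < P → ∃ λ L → Unique L × All (SpikeSum (suc p)) L × length L ≡ suc (2 * p)
    spike-sums zero _ = (h + 1 * g) % l ∷ [] , [] ∷ [] , with-h ≤-refl ≤-refl ∷ [] , refl
    spike-sums (suc p) p<P with spike-sums p (<⇒≤ p<P)
    ... | L , u , all , len =
      (h + suc (suc p) * g) % l ∷ (suc (suc p) * g) % l ∷ L ,
      (shifted≢multiple ∷ All.map (shifted-new p<P) all) ∷ All.map (multiple-new p<P) all ∷ u ,
      with-h (s≤s z≤n) ≤-refl ∷ without (s≤s (s≤s z≤n)) ≤-refl ∷ All.map SpikeSum-suc all ,
      trans (cong (λ n → suc (suc n)) len) (cong suc (sym (+-suc (suc p) (p + 0))))
      where
      shifted≢multiple : (h + suc (suc p) * g) % l ≢ (suc (suc p) * g) % l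
      shifted≢multiple e = h+tg≢0 {0} z≤n (trans (cong (_% l) (+-identityʳ h))
        (cancel-0 (suc (suc p) * g) h (trans (cong (_% l) (+-comm (suc (suc p) * g) h)) e)))

  many-sums-spike : ∀ {h g} p → h ≢ g → Free (h ∷ replicate (suc p) g) → ManySums (h ∷ replicate (suc p) g)
  many-sums-spike {h} {g} p h≢g F = record
    { sums = proj₁ found
    ; unique = proj₁ (proj₂ found)
    ; long = All.map to-long (proj₁ (proj₂ (proj₂ found)))
    ; count = count-≤ (length-replicate p) (proj₂ (proj₂ (proj₂ found))) }
    where
    open Free F
    tg≢0 : ∀ {t} → 1 ≤ t → t ≤ suc p → (t * g) % l ≢ 0
    tg≢0 1≤t t≤p = zero-free (skip (proj₂ (proj₂ (Part-replicate g t≤p)))) 1≤t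
    h+tg≢0 : ∀ {t} → t ≤ suc p → (h + t * g) % l ≢ 0
    h+tg≢0 t≤p = zero-free (take (proj₂ (proj₂ (Part-replicate g t≤p)))) (s≤s z≤n)
    tg≢h : ∀ {t} → 1 ≤ t → t ≤ suc p → (t * g) % l ≢ h % l
    tg≢h {suc zero} _ _ e = %-≢ (bounded (there (here refl))) (bounded (here refl)) (h≢g ∘ sym) (trans (cong (_% l) (sym (+-identityʳ g))) e)
    tg≢h {suc (suc t)} _ t≤p = atom-free (skip (proj₂ (proj₂ (Part-replicate g t≤p)))) (s≤s (s≤s z≤n)) (here refl)
    open SpikeSums h g (suc p) tg≢0 h+tg≢0 tg≢h
    found = spike-sums p ≤-refl
    to-long : ∀ {r} → SpikeSum (suc p) r → LongSum (h ∷ replicate (suc p) g) r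
    to-long (without 2≤t t≤p) = _ , _ , _ , _ , skip (proj₂ (proj₂ (Part-replicate g t≤p))) , 2≤t , refl
    to-long (with-h 1≤t t≤p) = _ , _ , _ , _ , take (proj₂ (proj₂ (Part-replicate g t≤p))) , s≤s 1≤t , refl
    count-≤ : ∀ {n s} → n ≡ p → s ≡ suc (2 * p) → 3 * suc (suc n) ≤ 2 * s + 4
    count-≤ {n} {s} h₁ h₂ = by≤ (3 ⊗ (≤-reflexive h₁) ⊕ 2 ⊗ (≤-reflexive (sym h₂))) p (solve (n ▹ p ▹ s ▹ □))

  many-sums-triple : ∀ {f g h} → g ≢ h → Free (f ∷ g ∷ h ∷ []) → ManySums (f ∷ g ∷ h ∷ [])
  many-sums-triple {f} {g} {h} g≢h F = record
    -- Three of the four long subsums suffice, as 3*3 ≤ 2*3 + 4; all of them contain f, so they are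
    -- compared after cancelling it or a longer common part.
    { sums = (f + (g + (h + 0))) % l ∷ (f + (h + 0)) % l ∷ (f + (g + 0)) % l ∷ []
    ; unique = ((λ e → zero-free {v = g + 0} (skip (take (skip done))) ≤-refl
                   (cancel-0 (f + (h + 0)) (g + 0) (trans (cong (_% l) (swap₁ f g h)) e))) ∷
                (λ e → zero-free {v = h + 0} (skip (skip (take done))) ≤-refl
                   (cancel-0 (f + (g + 0)) (h + 0) (trans (cong (_% l) (swap₂ f g h)) e))) ∷ []) ∷
               ((λ e → %-≢ (bounded (there (here refl))) (bounded (there (there (here refl)))) g≢h
                   (sym (subst₂ (λ x y → x % l ≡ y % l) (+-identityʳ h) (+-identityʳ g) (cancel f _ _ e)))) ∷ []) ∷ [] ∷ []
    ; long = (_ , _ , _ , _ , take (take (take done)) , s≤s (s≤s z≤n) , refl) ∷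
             (_ , _ , _ , _ , take (skip (take done)) , ≤-refl , refl) ∷
             (_ , _ , _ , _ , take (take (skip done)) , ≤-refl , refl) ∷ []
    ; count = n≤1+n 9 }
    where
    open Free F
    swap₁ : ∀ f g h → f + (h + 0) + (g + 0) ≡ f + (g + (h + 0))
    swap₁ f g h = solve (f ▹ h ▹ g ▹ □)
    swap₂ : ∀ f g h → f + (g + 0) + (h + 0) ≡ f + (g + (h + 0))
    swap₂ f g h = solve (f ▹ g ▹ h ▹ □)

  -- Each of the three new sums contains all of es together with x, y or both. If it were congruent
  -- to a subsum of es, what remains after removing that subsum would be a nonempty subsum congruent
  -- to 0.
  many-sums-pair : ∀ {x y es} → x ≢ y → 1 ≤ length es → Free (x ∷ y ∷ es) → ManySums es → ManySums (x ∷ y ∷ es)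
  many-sums-pair {x} {y} {es} x≢y 1≤es F M = record
    { sums = (x + (y + σ)) % l ∷ (x + σ) % l ∷ (y + σ) % l ∷ sums
    ; unique = (both≢x ∷ both≢y ∷ All.map both-new long) ∷ (x≢ ∷ All.map x-new long) ∷ All.map y-new long ∷ unique
    ; long = (_ , _ , _ , _ , take (take (Part-all es)) , s≤s (s≤s z≤n) , refl) ∷
             (_ , _ , _ , _ , take (skip (Part-all es)) , s≤s 1≤es , refl) ∷
             (_ , _ , _ , _ , skip (take (Part-all es)) , s≤s 1≤es , refl) ∷
             All.map (λ (_ , _ , _ , _ , p , h) → _ , _ , _ , _ , skip (skip p) , h) long
    ; count = count-≤ (length es) (length sums) count }
    where
    open Free F
    open ManySums M
    σ = sum es
    both≢x : (x + (y + σ)) % l ≢ (x + σ) % l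
    both≢x e = zero-free (skip (take (Part-none es))) ≤-refl (cancel-0 (x + σ) (y + 0) (trans (cong (_% l) (regroup x y σ)) e))
      where
      regroup : ∀ x y σ → x + σ + (y + 0) ≡ x + (y + σ)
      regroup x y σ = solve (x ▹ σ ▹ y ▹ □)
    both≢y : (x + (y + σ)) % l ≢ (y + σ) % l
    both≢y e = zero-free (take (skip (Part-none es))) ≤-refl (cancel-0 (y + σ) (x + 0) (trans (cong (_% l) (regroup x y σ)) e))
      where
      regroup : ∀ x y σ → y + σ + (x + 0) ≡ x + (y + σ)
      regroup x y σ = solve (y ▹ σ ▹ x ▹ □)
    x≢ : (x + σ) % l ≢ (y + σ) % l
    x≢ e = %-≢ (bounded (here refl)) (bounded (there (here refl))) x≢y
      (cancel σ x y (trans (cong (_% l) (+-comm σ x)) (trans e (cong (_% l) (+-comm y σ)))))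
    complement-zero : ∀ c {k v k′ v′} → Part es k v k′ v′ → (c + σ) % l ≡ v % l → (c + v′) % l ≡ 0
    complement-zero c {v = v} {v′ = v′} p e = cancel-0 v (c + v′) (trans (cong (_% l) (regroup (Part-sum p))) e)
      where
      regroup : ∀ {s} → v + v′ ≡ s → v + (c + v′) ≡ c + s
      regroup {s} h = by≡ h (solve (v ▹ v′ ▹ s ▹ c ▹ □))
    both-new : ∀ {r} → LongSum es r → (x + (y + σ)) % l ≢ r
    both-new (_ , _ , _ , v′ , p , _ , refl) e = zero-free (take (take (Part-swap p))) (s≤s z≤n)
      (trans (cong (_% l) (sym (+-assoc x y v′))) (complement-zero (x + y) p (trans (cong (_% l) (+-assoc x y σ)) e)))
    x-new : ∀ {r} → LongSum es r → (x + σ) % l ≢ r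
    x-new (_ , _ , _ , _ , p , _ , refl) e = zero-free (take (skip (Part-swap p))) (s≤s z≤n) (complement-zero x p e)
    y-new : ∀ {r} → LongSum es r → (y + σ) % l ≢ r
    y-new (_ , _ , _ , _ , p , _ , refl) e = zero-free (skip (take (Part-swap p))) (s≤s z≤n) (complement-zero y p e)
    count-≤ : ∀ n s → 3 * n ≤ 2 * s + 4 → 3 * suc (suc n) ≤ 2 * suc (suc (suc s)) + 4
    count-≤ n s h = by≤ h 0 (solve (n ▹ s ▹ □))

  many-sums-shape : ∀ {es} → Shape es → Free es → ManySums es
  many-sums-shape (spike p h≢g) F = many-sums-spike p h≢g F
  many-sums-shape (triple _ _ g≢h) F = many-sums-triple g≢h F
  many-sums-shape (pair x≢y s) F = many-sums-pair x≢y (Shape-nonempty s) F (many-sums-shape s (Free-tail (Free-tail F)))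

  constant-or-many-sums : ∀ es → Free es → (∃ λ g → es ≡ replicate (length es) g) ⊎ ManySums es
  constant-or-many-sums es F with constant-or-shape es
  ... | inj₁ const = inj₁ const
  ... | inj₂ (es′ , π , s) = inj₂ (ManySums-↭ (↭-sym π) (many-sums-shape s (Free-↭ π F)))

-- Minimal points of size 1+m

-- Reflecting B in σ/2 moves it off B and off the multiples of g; the part of B above σ is parked above l.
unit-step : ∀ {B l b m} g → Unique B → (∀ {c} → c ∈ B → c < l) → length B ≡ b →
  suc m * g < l → 2 ≤ g → (∀ t → t ≤ suc m → t * g ∈ B → ⊥) →
  (∀ {c d} → c ∈ B → d ∈ B → c + d ≢ suc m * g) → 3 * m + 2 * b + 5 ≤ 2 * l
unit-step {B} {l} {_} {m} g uB B<l refl σ<l 2≤g off-B no-sum =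
  count m (length B) l (*-monoʳ-≤ (suc m) 2≤g) (trans (+-assoc l _ _) (cong (l +_) (m∸n+n≡m σ<l))) total
  where
  σ = suc m * g
  -- The range above `l` has l - σ - 1 places, one for each number strictly between σ and `l`.
  K = l + (l ∸ suc σ)
  flip : ℕ → ℕ
  flip c with c <? σ
  ... | yes _ = σ ∸ c
  ... | no _ = l + (c ∸ suc σ)
  data Flip (c : ℕ) : ℕ → Set where
    low : ∀ {r} → c + r ≡ σ → Flip c r
    high : ∀ {r} → suc σ + r ≡ c → Flip c (l + r)
  flip-view : ∀ {c} → c ∈ B → Flip c (flip c)
  flip-view {c} c∈ with c <? σ
  ... | yes c<σ = low (m+[n∸m]≡n (<⇒≤ c<σ))
  ... | no c≮σ = high (m+[n∸m]≡n (≤∧≢⇒< (≮⇒≥ c≮σ) (λ { refl → off-B (suc m) ≤-refl c∈ })))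
  multiples = map (_* g) (upTo (suc (suc m)))
  multiple≤σ : ∀ {z} → z ∈ multiples → ∃ λ t → t ≤ suc m × z ≡ t * g
  multiple≤σ z∈ with ∈-map⁻ (_* g) z∈
  ... | t , t∈ , eq = t , ≤-pred (∈-upTo⁻ t∈) , eq
  multiple<l : ∀ {t} → t ≤ suc m → t * g < l
  multiple<l t≤ = ≤-<-trans (*-monoˡ-≤ g t≤) σ<l
  multiples-unique : Unique multiples
  multiples-unique = map-unique (λ {x} {y} _ _ → *-cancelʳ-≡ x y g {{>-nonZero (<⇒≤ 2≤g)}}) (Uniqueₚ.upTo⁺ (suc (suc m)))
  flip-injective : ∀ {c d} → c ∈ B → d ∈ B → flip c ≡ flip d → c ≡ d
  flip-injective {c} {d} c∈ d∈ eq = view (flip-view c∈) (flip-view d∈) eq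
    where
    view : ∀ {r s} → Flip c r → Flip d s → r ≡ s → c ≡ d
    view {r} (low e₁) (low e₂) refl = +-cancelʳ-≡ r c d (trans e₁ (sym e₂))
    view {r} (low e₁) (high e₂) refl = ⊥-elim (<⇒≱ σ<l (≤-trans (m≤m+n l _) (≤-trans (m≤n+m r c) (≤-reflexive e₁))))
    view {_} {r} (high e₁) (low e₂) refl = ⊥-elim (<⇒≱ σ<l (≤-trans (m≤m+n l _) (≤-trans (m≤n+m r d) (≤-reflexive e₂))))
    view (high {r} e₁) (high {s} e₂) eq = trans (sym e₁) (trans (cong (suc σ +_) (+-cancelˡ-≡ l r s eq)) e₂)
  flip-off-B : ∀ {z} → z ∈ B × z ∈ map flip B → ⊥
  flip-off-B (z∈ , z∈′) with ∈-map⁻ flip z∈′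
  ... | c , c∈ , refl = view (flip-view c∈) z∈
    where
    view : ∀ {r} → Flip c r → r ∈ B → ⊥
    view (low e) r∈ = no-sum c∈ r∈ e
    view (high _) r∈ = <⇒≱ (B<l r∈) (m≤m+n l _)
  flip-off-multiples : ∀ {z} → z ∈ multiples × z ∈ B ++ map flip B → ⊥
  flip-off-multiples (z∈ , z∈′) with multiple≤σ z∈ | ∈-++⁻ B z∈′
  ... | t , t≤ , refl | inj₁ z∈B = off-B t t≤ z∈B
  ... | t , t≤ , refl | inj₂ z∈map with ∈-map⁻ flip z∈map
  ...   | c , c∈ , e = view (flip-view c∈) e
    where
    view : ∀ {r} → Flip c r → t * g ≡ r → ⊥
    view (low e) refl = off-B (suc m ∸ t) (m∸n≤m (suc m) t) (subst (_∈ B)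
      (trans (sym (m+n∸n≡m c (t * g))) (trans (cong (_∸ t * g) e) (sym (*-distribʳ-∸ g (suc m) t)))) c∈)
    view (high {r} _) e = <⇒≱ (multiple<l t≤) (≤-trans (m≤m+n l r) (≤-reflexive (sym e)))
  total : suc (suc m) + (length B + length B) ≤ K
  total = ≤-trans (≤-reflexive (sym (trans (length-++ multiples) (cong₂ _+_ (trans (length-map _ (upTo (suc (suc m)))) (length-upTo (suc (suc m))))
      (trans (length-++ B) (cong (length B +_) (length-map flip B)))))))
    (unique-bounded (Uniqueₚ.++⁺ multiples-unique (Uniqueₚ.++⁺ uB (map-unique flip-injective uB) flip-off-B) flip-off-multiples) below)
    where
    flip<K : ∀ {c} → c ∈ B → flip c < K
    flip<K {c} c∈ = view (flip-view c∈)
      where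
      view : ∀ {r} → Flip c r → r < K
      view {r} (low e) = ≤-trans (s≤s (≤-trans (m≤n+m r c) (≤-reflexive e))) (≤-trans σ<l (m≤m+n l _))
      view (high {r} e) = +-monoʳ-< l (+-cancelˡ-≤ (suc σ) (suc r) (l ∸ suc σ)
        (≤-trans (≤-reflexive (trans (+-suc (suc σ) r) (cong suc e))) (≤-trans (B<l c∈) (≤-reflexive (sym (m+[n∸m]≡n σ<l))))))
    below : ∀ {z} → z ∈ multiples ++ (B ++ map flip B) → z < K
    below z∈ with ∈-++⁻ multiples z∈
    ... | inj₁ z∈m with multiple≤σ z∈m
    ...   | t , t≤ , refl = ≤-trans (multiple<l t≤) (m≤m+n l _)
    below z∈ | inj₂ z∈′ with ∈-++⁻ B z∈′
    ...   | inj₁ z∈B = ≤-trans (B<l z∈B) (m≤m+n l _)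
    ...   | inj₂ z∈map with ∈-map⁻ flip z∈map
    ...     | c , c∈ , refl = flip<K c∈
  count : ∀ m b l {K σ} → suc m * 2 ≤ σ → K + suc σ ≡ l + l → suc (suc m) + (b + b) ≤ K → 3 * m + 2 * b + 5 ≤ 2 * l
  count m b l {K} {σ} h₁ h₂ h₃ =
    by≤ (h₁ ⊕ ≤-reflexive h₂ ⊕ h₃) 0 (solve (m ▹ σ ▹ K ▹ l ▹ b ▹ □))

module LongMinimal (A : List ℕ) (uA : Unique A) (l : ℕ) .{{_ : NonZero l}}
  (0∈A : 0 ∈ A) (l∈A : l ∈ A) (A≤l : ∀ {a} → a ∈ A → a ≤ l) where

  open Sumset A l 0∈A l∈A A≤l
  open Growth l

  Part⇒Divides : ∀ {es k v k′ v′} → All (_∈ A) es → Part es k v k′ v′ → Divides k v (length es) (sum es)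
  Part⇒Divides [] done = divides sum-zero sum-zero refl refl
  Part⇒Divides (a∈ ∷ es∈) (take {e} {v = v} p) with Part⇒Divides es∈ p
  ... | divides {cv = cv} s c eq eq′ = divides (sum-suc a∈ s) c (cong suc eq) (trans (+-assoc e v cv) (cong (e +_) eq′))
  Part⇒Divides (a∈ ∷ es∈) (skip {e} {k = k} {v} p) with Part⇒Divides es∈ p
  ... | divides {ck} {cv} s c eq eq′ = divides s (sum-suc a∈ c) (trans (+-suc k ck) (cong suc eq)) (trans (+-left-comm v e cv) (cong (e +_) eq′))

  ∈⇒Divides : ∀ {es g} → All (_∈ A) es → g ∈ es → Divides 1 g (length es) (sum es)
  ∈⇒Divides (a∈ ∷ es∈) (here refl) = divides (S-one a∈) (list⇒S es∈) refl refl
  ∈⇒Divides (a∈ ∷ es∈) (there {e} {es} g∈) with ∈⇒Divides es∈ g∈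
  ... | divides {ck} {cv} s c eq eq′ = divides s (sum-suc a∈ c) (cong suc eq) (trans (+-left-comm _ e cv) (cong (e +_) eq′))

  -- If v = c + Y*l with 1 + Y ≤ k, then the single summand c with Y copies of `l` is a shorter
  -- origin of the point; a larger Y gives v ≥ k*l, which is too much.
  Minimal⇒atom-free : ∀ {k v} → Minimal k v → S k v → 2 ≤ k → ∀ {c} → c ∈ A → v % l ≢ c % l
  Minimal⇒atom-free {k} {v} min s 2≤k {c} c∈ e with %-≡-cases l v c e
  ... | inj₂ (Y , refl) = <⇒≱ (Minimal⇒0< min s (<⇒≤ 2≤k)) (+-cancelʳ-≤ l v 0 (≤-trans (+-monoʳ-≤ v (m≤m+n l (Y * l))) (A≤l c∈)))
  ... | inj₁ (Y , refl) with suc Y ≤? k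
  ...   | yes Y<k = min Y (S-one c∈) refl Y<k 2≤k
  ...   | no Y≮k = <⇒≱ (Minimal⇒<k*l min s (<⇒≤ 2≤k)) (≤-trans (*-monoˡ-≤ l (≤-pred (≰⇒> Y≮k))) (m≤n+m (Y * l) c))

  Minimal⇒Free : ∀ {es} → All (_∈ A) es → Minimal (length es) (sum es) → Free es
  Minimal⇒Free {es} es∈ min = record
    { bounded = λ {g} g∈ → let d = ∈⇒Divides es∈ g∈ in
        subst (g <_) (+-identityʳ l) (Minimal⇒<k*l (Minimal-part min d) (Divides.part d) ≤-refl)
    ; zero-free = λ p 1≤k e → let d = Part⇒Divides es∈ p ; Y , eq = %-≡0 l _ e in
        Minimal⇒zero-free (Minimal-part min d) (Divides.part d) 1≤k Y eq
    ; atom-free = λ p 2≤k g∈ → let d = Part⇒Divides es∈ p in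
        Minimal⇒atom-free (Minimal-part min d) (Divides.part d) 2≤k (All.lookup es∈ g∈) }

  residues : List ℕ
  residues = filter (_<? l) A

  residues-unique : Unique residues
  residues-unique = Uniqueₚ.filter⁺ (_<? l) uA

  ∈-residues⁻ : ∀ {a} → a ∈ residues → a ∈ A × a < l
  ∈-residues⁻ = ∈-filter⁻ (_<? l)

  length-residues : length A ≤ suc (length residues)
  length-residues = unique-⊆⇒length≤ uA into
    where
    into : ∀ {a} → a ∈ A → a ∈ l ∷ residues
    into {a} a∈ with a <? l
    ... | yes a<l = there (∈-filter⁺ (_<? l) a∈ a<l)
    ... | no a≮l = here (≤-antisym (A≤l a∈) (≮⇒≥ a≮l))

  -- The long subsums avoid the classes of A, so both families together occupy at most l classes.
  ManySums⇒length : ∀ {es} → All (_∈ A) es → Minimal (length es) (sum es) → ManySums es →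
    3 * length es + 2 * length A ≤ 2 * l + 6
  ManySums⇒length {es} es∈ min M = combine (length es) count length-residues
    (≤-trans (≤-reflexive (sym (length-++ sums))) (unique-bounded (Uniqueₚ.++⁺ unique residues-unique disjoint) below))
    where
    open ManySums M
    disjoint : ∀ {z} → z ∈ sums × z ∈ residues → ⊥
    disjoint (z∈ , z∈′) with All.lookup long z∈ | ∈-residues⁻ z∈′
    ... | _ , _ , _ , _ , p , 2≤k , refl | z∈A , z<l = let d = Part⇒Divides es∈ p in
      Minimal⇒atom-free (Minimal-part min d) (Divides.part d) 2≤k z∈A (sym (m<n⇒m%n≡m z<l))
    below : ∀ {z} → z ∈ sums ++ residues → z < l
    below z∈ with ∈-++⁻ sums z∈
    ... | inj₂ z∈r = proj₂ (∈-residues⁻ z∈r)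
    ... | inj₁ z∈s with All.lookup long z∈s
    ...   | _ , v , _ , _ , _ , _ , refl = m%n<n v l
    combine : ∀ k {s n r} → 3 * k ≤ 2 * s + 4 → n ≤ suc r → s + r ≤ l → 3 * k + 2 * n ≤ 2 * l + 6
    combine k {s} {n} {r} h₁ h₂ h₃ =
      by≤ (h₁ ⊕ 2 ⊗ h₂ ⊕ 2 ⊗ h₃) 0 (solve (k ▹ s ▹ n ▹ r ▹ l ▹ □))

  C₁ C₂ : ℕ → Set
  C₁ m = (1 ∈ A) × (∀ a → a ∈ A → (a ≤ 1) ⊎ ((m + 2 ≤ a) × (a ≤ l)))
  C₂ m = ((l ∸ 1) ∈ A) × (l ∈ A) × (∀ a → a ∈ A → (a + (m + 2) ≤ l) ⊎ ((a ≡ l ∸ 1) ⊎ (a ≡ l)))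

  module Constant (m g : ℕ) (g∈A : g ∈ A) (min : Minimal (suc m) (suc m * g))
    (2m+3n : 2 * l + 9 ≤ 2 * m + 3 * length A) (3m+2n : 2 * l + 4 ≤ 3 * m + 2 * length A) where

    private
      n = length A
      σ = suc m * g

    S-multiple : ∀ t → S t (t * g)
    S-multiple zero = sum-zero
    S-multiple (suc t) = sum-suc g∈A (S-multiple t)

    multiple-divides : ∀ {t} → t ≤ suc m → Divides t (t * g) (suc m) σ
    multiple-divides {t} t≤ = divides (S-multiple t) (S-multiple (suc m ∸ t)) (m+[n∸m]≡n t≤)
      (trans (sym (*-distribʳ-+ g t (suc m ∸ t))) (cong (_* g) (m+[n∸m]≡n t≤)))

    multiple≢0 : ∀ {t} → 1 ≤ t → t ≤ suc m → (t * g) % l ≢ 0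
    multiple≢0 {t} 1≤t t≤ e with %-≡0 l (t * g) e
    ... | Y , eq = Minimal⇒zero-free (Minimal-part min (multiple-divides t≤)) (S-multiple t) 1≤t Y eq

    multiple≢atom : ∀ {t c} → 2 ≤ t → t ≤ suc m → c ∈ A → (t * g) % l ≢ c % l
    multiple≢atom {t} 2≤t t≤ = Minimal⇒atom-free (Minimal-part min (multiple-divides t≤)) (S-multiple t) 2≤t

    0<g : 0 < g
    0<g = n≢0⇒n>0 λ g≡0 → multiple≢0 {1} ≤-refl (s≤s z≤n)
      (trans (cong (λ h → (1 * h) % l) g≡0) (m<n⇒m%n≡m (>-nonZero⁻¹ l)))

    g<l : g < l
    g<l = subst₂ _<_ (+-identityʳ g) (+-identityʳ l)
      (Minimal⇒<k*l (Minimal-part min (multiple-divides {1} (s≤s z≤n))) (S-multiple 1) ≤-refl)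

    Other : ℕ → Set
    Other a = a < l × a ≢ 0 × a ≢ g

    other? : Decidable Other
    other? a = (a <? l) ×-dec (¬? (a ≟ 0) ×-dec ¬? (a ≟ g))

    B : List ℕ
    B = filter other? A

    ∈B⁻ : ∀ {c} → c ∈ B → c ∈ A × Other c
    ∈B⁻ = ∈-filter⁻ other?

    B<l : ∀ {c} → c ∈ B → c < l
    B<l c∈ = proj₁ (proj₂ (∈B⁻ c∈))

    uB : Unique B
    uB = Uniqueₚ.filter⁺ other? uA

    n≤3+∣B∣ : n ≤ 3 + length B
    n≤3+∣B∣ = unique-⊆⇒length≤ uA into
      where
      into : ∀ {a} → a ∈ A → a ∈ l ∷ 0 ∷ g ∷ B
      into {a} a∈ with a <? l | a ≟ 0 | a ≟ g
      ... | no a≮l | _ | _ = here (≤-antisym (A≤l a∈) (≮⇒≥ a≮l))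
      ... | yes _ | yes refl | _ = there (here refl)
      ... | yes _ | no _ | yes refl = there (there (here refl))
      ... | yes a<l | no a≢0 | no a≢g = there (there (there (∈-filter⁺ other? a∈ (a<l , a≢0 , a≢g))))

    multiple≢other : ∀ {t c} → t ≤ suc m → c ∈ B → (t * g) % l ≢ c
    multiple≢other {t} {c} t≤ c∈ e with ∈B⁻ c∈
    ... | c∈A , c<l , c≢0 , c≢g with t
    ...   | zero = c≢0 (trans (sym e) (m<n⇒m%n≡m (>-nonZero⁻¹ l)))
    ...   | suc zero = c≢g (trans (sym e) (trans (cong (_% l) (+-identityʳ g)) (m<n⇒m%n≡m g<l)))
    ...   | suc (suc t′) = multiple≢atom (s≤s (s≤s z≤n)) t≤ c∈A (trans e (sym (m<n⇒m%n≡m c<l)))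

    multiples : List ℕ
    multiples = map (λ t → (t * g) % l) (upTo (suc (suc m)))

    multiple-injective : ∀ {t t′} → t ≤ suc m → t′ ≤ suc m → t ≤ t′ → (t * g) % l ≡ (t′ * g) % l → t ≡ t′
    multiple-injective {t} {t′} t≤ t′≤ t≤t′ e with t ≟ t′
    ... | yes t≡t′ = t≡t′
    ... | no t≢t′ = ⊥-elim (multiple≢0 {t′ ∸ t} (m<n⇒0<n∸m (≤∧≢⇒< t≤t′ t≢t′)) (≤-trans (m∸n≤m t′ t) t′≤)
      (trans (%-cancel-+ˡ l (t * g) ((t′ ∸ t) * g) 0 (trans (cong (_% l) split)
        (trans (sym e) (cong (_% l) (sym (+-identityʳ (t * g))))))) (m<n⇒m%n≡m (>-nonZero⁻¹ l))))
      where
      split : t * g + (t′ ∸ t) * g ≡ t′ * g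
      split = trans (sym (*-distribʳ-+ g t (t′ ∸ t))) (cong (_* g) (m+[n∸m]≡n t≤t′))

    multiples-unique : Unique multiples
    multiples-unique = map-unique inj (Uniqueₚ.upTo⁺ (suc (suc m)))
      where
      inj : ∀ {t t′} → t ∈ upTo (suc (suc m)) → t′ ∈ upTo (suc (suc m)) → (t * g) % l ≡ (t′ * g) % l → t ≡ t′
      inj {t} {t′} t∈ t′∈ e with ≤-total t t′
      ... | inj₁ t≤t′ = multiple-injective (≤-pred (∈-upTo⁻ t∈)) (≤-pred (∈-upTo⁻ t′∈)) t≤t′ e
      ... | inj₂ t′≤t = sym (multiple-injective (≤-pred (∈-upTo⁻ t′∈)) (≤-pred (∈-upTo⁻ t∈)) t′≤t (sym e))

    ∈multiples⁻ : ∀ {z} → z ∈ multiples → ∃ λ t → t ≤ suc m × z ≡ (t * g) % l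
    ∈multiples⁻ z∈ with ∈-map⁻ (λ t → (t * g) % l) z∈
    ... | t , t∈ , eq = t , ≤-pred (∈-upTo⁻ t∈) , eq

    length-multiples : length multiples ≡ suc (suc m)
    length-multiples = trans (length-map (λ t → (t * g) % l) (upTo (suc (suc m)))) (length-upTo (suc (suc m)))

    multiples-below : ∀ {z} → z ∈ multiples → z < l
    multiples-below z∈ with ∈multiples⁻ z∈
    ... | t , _ , refl = m%n<n (t * g) l

    multiples-off-B : ∀ {z} → z ∈ multiples × z ∈ B → ⊥
    multiples-off-B (z∈ , z∈B) with ∈multiples⁻ z∈
    ... | t , t≤ , refl = multiple≢other t≤ z∈B refl

    -- Makes a sum of two elements count as shorter than 1+m summands, on which `not-two` relies.
    2≤m : 2 ≤ m
    2≤m = combine n≤3+∣B∣ 3m+2n (≤-trans (≤-reflexive (trans (cong (_+ length B) (sym length-multiples)) (sym (length-++ multiples))))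
        (unique-bounded (Uniqueₚ.++⁺ multiples-unique uB multiples-off-B) ([ multiples-below , B<l ]′ ∘ ∈-++⁻ multiples)))
      where
      combine : ∀ {n b} → n ≤ 3 + b → 2 * l + 4 ≤ 3 * m + 2 * n → suc (suc m) + b ≤ l → 2 ≤ m
      combine {n} {b} h₁ h₂ h₃ = by≤ (2 ⊗ h₁ ⊕ h₂ ⊕ 2 ⊗ h₃) 0 (solve (n ▹ b ▹ l ▹ m ▹ □))

    not-two : ∀ {c d} Y → c ∈ B → d ∈ B → c + d + Y * l ≡ σ → suc Y ≤ m → ⊥
    not-two Y c∈ d∈ e Y<m = min Y (S-two (proj₁ (∈B⁻ c∈)) (proj₁ (∈B⁻ d∈))) e (s≤s Y<m) (s≤s 2≤m)

    -- Otherwise `B`, its reflection σ - B and the m + 2 multiples of g are pairwise disjoint modulo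
    -- `l`, which is too many classes because `B` has at least n - 3 elements.
    σ-two-fold : ∃₂ λ c d → c ∈ B × d ∈ B × (c + d) % l ≡ σ % l
    σ-two-fold with any? (λ c → any? (λ d → (c + d) % l ≟ σ % l) B) B
    ... | yes found = let c , c∈ , found′ = find found ; d , d∈ , e = find found′ in c , d , c∈ , d∈ , e
    ... | no none = ⊥-elim (combine n≤3+∣B∣ 2m+3n 3m+2n total)
      where
      reflect : ℕ → ℕ
      reflect c = (σ + (l ∸ c)) % l
      +reflect : ∀ {c} → c ∈ B → ∀ d → (d + c + (σ + (l ∸ c))) % l ≡ (d + σ) % l
      +reflect {c} c∈ d =
        trans (cong (_% l) (regroup d c σ (l ∸ c))) (trans (cong (λ s → (d + σ + s) % l) (m+[n∸m]≡n (<⇒≤ (B<l c∈)))) ([m+n]%n≡m%n (d + σ) l))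
        where
        regroup : ∀ d c σ s → d + c + (σ + s) ≡ d + σ + (c + s)
        regroup d c σ s = solve (d ▹ c ▹ σ ▹ s ▹ □)
      reflect-injective : ∀ {c d} → c ∈ B → d ∈ B → reflect c ≡ reflect d → c ≡ d
      reflect-injective {c} {d} c∈ d∈ e = %-injective l (B<l c∈) (B<l d∈) (%-cancel-+ˡ l σ c d
        (trans (cong (_% l) (+-comm σ c)) (trans (sym (+reflect d∈ c))
          (trans (%-cong-+ l {c + d} {d + c} (cong (_% l) (+-comm c d)) (sym e)) (trans (+reflect c∈ d) (cong (_% l) (+-comm d σ)))))))
      reflect-cancels : ∀ {c} w → c ∈ B → w % l ≡ reflect c → (c + w) % l ≡ σ % l
      reflect-cancels {c} w c∈ e = trans (%-cong-+ l {c} {c} {w} refl e) (+reflect c∈ 0)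
      B-off-reflect : ∀ {z} → z ∈ B × z ∈ map reflect B → ⊥
      B-off-reflect {z} (z∈ , z∈′) with ∈-map⁻ reflect z∈′
      ... | c , c∈ , e = none (lose c∈ (lose z∈ (reflect-cancels z c∈ (trans (m<n⇒m%n≡m (B<l z∈)) e))))
      multiples-off : ∀ {z} → z ∈ multiples × z ∈ B ++ map reflect B → ⊥
      multiples-off (z∈ , z∈′) with ∈-++⁻ B z∈′
      ... | inj₁ z∈B = multiples-off-B (z∈ , z∈B)
      ... | inj₂ z∈map with ∈multiples⁻ z∈ | ∈-map⁻ reflect z∈map
      ...   | t , t≤ , refl | c , c∈ , e = multiple≢other {suc m ∸ t} (m∸n≤m (suc m) t) c∈
        (trans (%-cancel-+ˡ l (t * g) ((suc m ∸ t) * g) c (trans (cong (_% l) split)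
          (trans (sym (reflect-cancels (t * g) c∈ e)) (cong (_% l) (+-comm c (t * g)))))) (m<n⇒m%n≡m (B<l c∈)))
        where
        split : t * g + (suc m ∸ t) * g ≡ σ
        split = trans (sym (*-distribʳ-+ g t (suc m ∸ t))) (cong (_* g) (m+[n∸m]≡n t≤))
      total : suc (suc m) + (length B + length B) ≤ l
      total = ≤-trans (≤-reflexive (sym (trans (length-++ multiples) (cong₂ _+_ length-multiples
          (trans (length-++ B) (cong (length B +_) (length-map reflect B)))))))
        (unique-bounded (Uniqueₚ.++⁺ multiples-unique (Uniqueₚ.++⁺ uB (map-unique reflect-injective uB) B-off-reflect) multiples-off)
          ([ multiples-below , [ B<l , reflect-below ]′ ∘ ∈-++⁻ B ]′ ∘ ∈-++⁻ multiples))
        where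
        reflect-below : ∀ {z} → z ∈ map reflect B → z < l
        reflect-below z∈ with ∈-map⁻ reflect z∈
        ... | c , _ , refl = m%n<n (σ + (l ∸ c)) l
      combine : ∀ {n b} → n ≤ 3 + b → 2 * l + 9 ≤ 2 * m + 3 * n → 2 * l + 4 ≤ 3 * m + 2 * n → suc (suc m) + (b + b) ≤ l → ⊥
      combine {n} {b} h₁ h₂ h₃ h₄ = by⊥ (3 ⊗ h₁ ⊕ h₂ ⊕ 2 ⊗ h₄) (b + 3) (solve (n ▹ b ▹ l ▹ m ▹ □))

    private
      too-few : ∀ {b} → b ≡ length B → 3 * m + 2 * b + 5 ≤ 2 * l → ⊥
      too-few {b} h₀ h = combine (subst (λ b → n ≤ 3 + b) (sym h₀) n≤3+∣B∣) 3m+2n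
        where
        combine : ∀ {n} → n ≤ 3 + b → 2 * l + 4 ≤ 3 * m + 2 * n → ⊥
        combine {n} h₁ h₂ = by⊥ (h ⊕ 2 ⊗ h₁ ⊕ h₂) 2 (solve (m ▹ b ▹ l ▹ n ▹ □))

    σ<l⇒g≡1 : σ < l → g ≡ 1
    σ<l⇒g≡1 σ<l = ≤-antisym (≮⇒≥ λ 2≤g → too-few refl (unit-step g uB B<l refl σ<l 2≤g
        (λ t t≤ t∈ → multiple≢other t≤ t∈ (m<n⇒m%n≡m (≤-<-trans (*-monoˡ-≤ g t≤) σ<l)))
        (λ c∈ d∈ e → not-two 0 c∈ d∈ (trans (+-identityʳ _) e) (<⇒≤ 2≤m)))) 0<g

    g≡1⇒C₁ : g ≡ 1 → C₁ m
    g≡1⇒C₁ refl = g∈A , dichotomy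
      where
      dichotomy : ∀ a → a ∈ A → (a ≤ 1) ⊎ ((m + 2 ≤ a) × (a ≤ l))
      dichotomy a a∈ with a ≤? 1 | m + 2 ≤? a
      ... | yes a≤1 | _ = inj₁ a≤1
      ... | no _ | yes m+2≤a = inj₂ (m+2≤a , A≤l a∈)
      ... | no a≰1 | no m+2≰a = ⊥-elim (multiple≢atom (≰⇒> a≰1)
        (≤-pred (≤-trans (≰⇒> m+2≰a) (≤-reflexive (+-comm m 2)))) a∈ (cong (_% l) (*-identityʳ a)))

    private
      h = l ∸ g

    h+g≡l : h + g ≡ l
    h+g≡l = m∸n+n≡m (<⇒≤ g<l)

    t*h+t*g≡t*l : ∀ t → t * h + t * g ≡ t * l
    t*h+t*g≡t*l t = trans (sym (*-distribˡ-+ t h g)) (cong (t *_) h+g≡l)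

    co-multiple : ∀ {t c} → t * h + c ≡ l → (t * g) % l ≡ c % l
    co-multiple {t} {c} e = %-cancel-+ˡ l (t * h) (t * g) c
      (trans (cong (_% l) (t*h+t*g≡t*l t)) (trans ([m+kn]%n≡m%n 0 t l)
        (sym (trans (cong (_% l) (trans e (sym (+-identityʳ l)))) ([m+kn]%n≡m%n 0 1 l)))))

    -- The count of `unit-step` for l - B and h = l - g. Two reflected elements with sum (1+m)*h
    -- correspond to σ = c + d + (m-1)*l, which minimality forbids.
    co-σ<l⇒h≡1 : suc m * h < l → h ≡ 1
    co-σ<l⇒h≡1 σ′<l = ≤-antisym (≮⇒≥ λ 2≤h → too-few (length-map (l ∸_) B)
        (unit-step h (map-unique co-injective uB) co<l refl σ′<l 2≤h co-off co-no-sum)) (m<n⇒0<n∸m g<l)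
      where
      ∈co⁻ : ∀ {z} → z ∈ map (l ∸_) B → ∃ λ c → c ∈ B × z + c ≡ l
      ∈co⁻ z∈ with ∈-map⁻ (l ∸_) z∈
      ... | c , c∈ , refl = c , c∈ , m∸n+n≡m (<⇒≤ (B<l c∈))
      co-injective : ∀ {c d} → c ∈ B → d ∈ B → l ∸ c ≡ l ∸ d → c ≡ d
      co-injective c∈ d∈ = ∸-cancelˡ-≡ (<⇒≤ (B<l c∈)) (<⇒≤ (B<l d∈))
      co<l : ∀ {z} → z ∈ map (l ∸_) B → z < l
      co<l {z} z∈ with ∈co⁻ z∈
      ... | c , c∈ , e = ≤-trans
        (≤-trans (≤-reflexive (+-comm 1 z)) (+-monoʳ-≤ z (n≢0⇒n>0 (proj₁ (proj₂ (proj₂ (∈B⁻ c∈))))))) (≤-reflexive e)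
      co-off : ∀ t → t ≤ suc m → t * h ∈ map (l ∸_) B → ⊥
      co-off t t≤ th∈ with ∈co⁻ th∈
      ... | c , c∈ , e = multiple≢other t≤ c∈ (trans (co-multiple {t} e) (m<n⇒m%n≡m (B<l c∈)))
      co-no-sum : ∀ {u w} → u ∈ map (l ∸_) B → w ∈ map (l ∸_) B → u + w ≢ suc m * h
      co-no-sum {u} {w} u∈ w∈ e with ∈co⁻ u∈ | ∈co⁻ w∈
      ... | c , c∈ , e₁ | d , d∈ , e₂ = with-m (m∸n+n≡m (<⇒≤ 2≤m)) (t*h+t*g≡t*l (suc m))
        where
        with-m : ∀ {m′} → m′ + 1 ≡ m → suc m * h + σ ≡ suc m * l → ⊥
        with-m {m′} refl e₃ = not-two m′ c∈ d∈ (value e e₃) (≤-reflexive (+-comm 1 m′))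
          where
          value : ∀ {σ σ′} → u + w ≡ σ′ → σ′ + σ ≡ suc (m′ + 1) * l → c + d + m′ * l ≡ σ
          value {σ} {σ′} h₁ h₂ = by≡ ((sym h₁) ⊞ (sym h₂) ⊞ e₁ ⊞ e₂) (solve (u ▹ w ▹ σ′ ▹ σ ▹ m′ ▹ l ▹ c ▹ d ▹ □))

    h≡1⇒C₂ : h ≡ 1 → C₂ m
    h≡1⇒C₂ h≡1 = subst (_∈ A) (sym l∸1≡g) g∈A , l∈A , dichotomy
      where
      1+g≡l : 1 + g ≡ l
      1+g≡l = subst (λ h → h + g ≡ l) h≡1 h+g≡l
      l∸1≡g : l ∸ 1 ≡ g
      l∸1≡g = cong (_∸ 1) (sym 1+g≡l)
      dichotomy : ∀ a → a ∈ A → (a + (m + 2) ≤ l) ⊎ ((a ≡ l ∸ 1) ⊎ (a ≡ l))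
      dichotomy a a∈ with a + (m + 2) ≤? l | a ≟ l ∸ 1 | a ≟ l
      ... | yes a≤ | _ | _ = inj₁ a≤
      ... | no _ | yes a≡ | _ = inj₂ (inj₁ a≡)
      ... | no _ | no _ | yes a≡ = inj₂ (inj₂ a≡)
      ... | no a≰ | no a≢l-1 | no a≢l = ⊥-elim (multiple≢atom {l ∸ a} {a} 2≤t t≤ a∈
        (co-multiple {l ∸ a} (trans (cong (_+ a) (trans (cong ((l ∸ a) *_) h≡1) (*-identityʳ (l ∸ a)))) t+a≡l)))
        where
        t+a≡l : l ∸ a + a ≡ l
        t+a≡l = m∸n+n≡m (A≤l a∈)
        2≤t : 2 ≤ l ∸ a
        2≤t with l ∸ a in eq
        ... | zero = ⊥-elim (a≢l (≤-antisym (A≤l a∈) (m∸n≡0⇒m≤n eq)))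
        ... | suc zero = ⊥-elim (a≢l-1 (sym (cong (_∸ 1) (trans (sym t+a≡l) (cong (_+ a) eq)))))
        ... | suc (suc _) = s≤s (s≤s z≤n)
        t≤ : l ∸ a ≤ suc m
        t≤ = bound t+a≡l (≰⇒> a≰)
          where
          bound : ∀ {t} → t + a ≡ l → l < a + (m + 2) → t ≤ suc m
          bound {t} h₁ h₂ = by≤ (≤-reflexive h₁ ⊕ h₂) 0 (solve (t ▹ a ▹ l ▹ m ▹ □))

    conclusion : C₁ m ⊎ C₂ m
    conclusion with σ-two-fold
    ... | c , d , c∈ , d∈ , e with %-≡-cases l σ (c + d) (sym e)
    -- Here c + d exceeds σ by a positive multiple of `l` but stays below 2*l, so σ < l.
    ...   | inj₂ (Y , e′) = inj₁ (g≡1⇒C₁ (σ<l⇒g≡1 (bound (B<l c∈) (B<l d∈) e′)))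
      where
      bound : ∀ {σ} → c < l → d < l → c + d ≡ σ + suc Y * l → σ < l
      bound {σ} h₁ h₂ h₃ = by≤ (h₁ ⊕ h₂ ⊕ ≤-reflexive (sym h₃)) (Y * l + 1) (solve (c ▹ l ▹ d ▹ σ ▹ Y ▹ □))
    ...   | inj₁ (Y , e′) with suc Y ≤? m
    ...     | yes Y<m = ⊥-elim (not-two Y c∈ d∈ (sym e′) Y<m)
    -- Now σ > m*l, that is (1+m)*(l-g) < l: the reflected point is the small one.
    ...     | no Y≮m = inj₂ (h≡1⇒C₂ (co-σ<l⇒h≡1 (bound (t*h+t*g≡t*l (suc m)) e′
        (n≢0⇒n>0 (proj₁ (proj₂ (proj₂ (∈B⁻ c∈))))) (*-monoˡ-≤ l (≤-pred (≰⇒> Y≮m))))))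
      where
      bound : ∀ {σ σ′} → σ′ + σ ≡ suc m * l → σ ≡ c + d + Y * l → 0 < c → m * l ≤ Y * l → σ′ < l
      bound {σ} {σ′} h₁ h₂ h₃ h₄ =
        by≤ (≤-reflexive h₁ ⊕ ≤-reflexive (sym h₂) ⊕ h₃ ⊕ h₄) d (solve (σ′ ▹ σ ▹ m ▹ l ▹ c ▹ d ▹ Y ▹ □))

  long-minimal : ∀ m → 2 * l + 9 ≤ 2 * m + 3 * length A → 2 * l + 4 ≤ 3 * m + 2 * length A →
    ∀ {v} → S (suc m) v → Minimal (suc m) v → C₁ m ⊎ C₂ m
  long-minimal m 2m+3n 3m+2n {v} s min with S⇒list s
  ... | es , es∈ , len , total = cases (constant-or-many-sums es (Minimal⇒Free es∈ min′))
    where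
    min′ : Minimal (length es) (sum es)
    min′ = subst₂ Minimal (sym len) (sym total) min
    sum-replicate : ∀ k g → sum (replicate k g) ≡ k * g
    sum-replicate zero g = refl
    sum-replicate (suc k) g = cong (g +_) (sum-replicate k g)
    cases : (∃ λ g → es ≡ replicate (length es) g) ⊎ ManySums es → C₁ m ⊎ C₂ m
    cases (inj₂ M) = ⊥-elim (contra (length A) 3m+2n (subst (λ k → 3 * k + 2 * length A ≤ 2 * l + 6) len (ManySums⇒length es∈ min′ M)))
      where
      -- The second bound on m gives 3(1+m) + 2n ≥ 2l + 7, one more than the count of subsums
      -- allows.
      contra : ∀ n → 2 * l + 4 ≤ 3 * m + 2 * n → 3 * suc m + 2 * n ≤ 2 * l + 6 → ⊥
      contra n h₁ h₂ = by⊥ (h₁ ⊕ h₂) 0 (solve (l ▹ m ▹ n ▹ □))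
    cases (inj₁ (g , eq)) = Constant.conclusion m g (All.head (subst (All (_∈ A)) es≡ es∈))
      (subst (Minimal (suc m)) (trans (sym total) (trans (cong sum es≡) (sum-replicate (suc m) g))) min) 2m+3n 3m+2n
      where
      es≡ : es ≡ replicate (suc m) g
      es≡ = trans eq (cong (λ k → replicate k g) len)

-- Partial sums of two minimal points

module Chains (A : List ℕ) (l : ℕ) .{{_ : NonZero l}} (0∈A : 0 ∈ A) (l∈A : l ∈ A) (A≤l : ∀ {a} → a ∈ A → a ≤ l) where

  open Sumset A l 0∈A l∈A A≤l

  record Chain (P : ℕ → ℕ → Set) (K V : ℕ) : Set where
    field
      classes : List ℕ
      unique : Unique classes
      members : All (λ r → ∃₂ λ k v → Divides k v K V × P k v × r ≡ v % l) classes

  ZeroFree : ℕ → ℕ → Set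
  ZeroFree K V = ∀ {k v} → Divides k v K V → 1 ≤ k → v % l ≢ 0

  Minimal⇒ZeroFree : ∀ {K V} → Minimal K V → ZeroFree K V
  Minimal⇒ZeroFree min d 1≤k e with %-≡0 l _ e
  ... | Y , eq = Minimal⇒zero-free (Minimal-part min d) (Divides.part d) 1≤k Y eq

  ZeroFree-tail : ∀ {x K V} → x ∈ A → ZeroFree (suc K) (x + V) → ZeroFree K V
  ZeroFree-tail x∈ zf d = zf (Divides-+ʳ d (S-one x∈))

  module _ {P : ℕ → ℕ → Set} where

    empty : ∀ {K V} → Chain P K V
    empty = record { classes = [] ; unique = [] ; members = [] }

    -- If the full sum repeated the class of a subsum, the complement of that subsum, which contains
    -- x, would be congruent to 0.
    grow : ∀ {x K V} → x ∈ A → S K V → ZeroFree (suc K) (x + V) → P (suc K) (x + V) → Chain P K V → Chain P (suc K) (x + V)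
    grow {x} {K} {V} x∈ s zf p c = record
      { classes = (x + V) % l ∷ classes
      ; unique = All.map new members ∷ unique
      ; members = (_ , _ , Divides-refl (sum-suc x∈ s) , p , refl) ∷
                  All.map (λ (k , v , d , q , e) → k , v , Divides-+ʳ d (S-one x∈) , q , e) members }
      where
      open Chain c
      new : ∀ {r} → (∃₂ λ k v → Divides k v K V × P k v × r ≡ v % l) → (x + V) % l ≢ r
      new (k , v , divides {ck} {cv} s′ c′ refl refl , _ , refl) e =
        zf {suc ck} {x + cv} (divides (sum-suc x∈ c′) s′ (cong suc (+-comm ck k)) (regroup x cv v)) (s≤s z≤n)
          (trans (%-cancel-+ˡ l v (x + cv) 0 (trans (cong (_% l) (trans (+-comm v (x + cv)) (regroup x cv v)))
            (trans e (cong (_% l) (sym (+-identityʳ v)))))) (m<n⇒m%n≡m (>-nonZero⁻¹ l)))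
        where
        regroup : ∀ x c v → x + c + v ≡ x + (v + c)
        regroup x c v = solve (x ▹ c ▹ v ▹ □)

    -- The classes of the suffixes of es, from the longest down to the first one violating C.
    suffixes : {C : ℕ → ℕ → Set} → (∀ k v → Dec (C k v)) → ¬ C 0 0 → ∀ {es} → All (_∈ A) es →
      ZeroFree (length es) (sum es) → (∀ {k v} → Divides k v (length es) (sum es) → C k v → P k v) →
      ∃ λ (c : Chain P (length es) (sum es)) → ∃₂ λ k v →
        Divides k v (length es) (sum es) × ¬ C k v × length es ≡ length (Chain.classes c) + k
    suffixes C? ¬C00 [] zf C⇒P = empty , 0 , 0 , Divides-refl sum-zero , ¬C00 , refl
    suffixes C? ¬C00 {x ∷ es} (x∈ ∷ es∈) zf C⇒P with C? (suc (length es)) (x + sum es)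
    ... | no ¬C = empty , _ , _ , Divides-refl (sum-suc x∈ (list⇒S es∈)) , ¬C , refl
    ... | yes Cxs with suffixes C? ¬C00 es∈ (ZeroFree-tail x∈ zf) (λ d → C⇒P (Divides-+ʳ d (S-one x∈)))
    ...   | c , k , v , d , ¬C , len = grow x∈ (list⇒S es∈) zf (C⇒P (Divides-refl (sum-suc x∈ (list⇒S es∈))) Cxs) c ,
      k , v , Divides-+ʳ d (S-one x∈) , ¬C , cong suc len

    extend : ∀ {xs K V} → All (_∈ A) xs → S K V → ZeroFree (length xs + K) (sum xs + V) →
      (∀ {k v} → Divides k v (length xs + K) (sum xs + V) → suc K ≤ k → V ≤ v → P k v) → (c : Chain P K V) →
      ∃ λ (c′ : Chain P (length xs + K) (sum xs + V)) → length (Chain.classes c′) ≡ length xs + length (Chain.classes c)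
    extend [] s zf p c = c , refl
    extend {x ∷ xs} {K} {V} (x∈ ∷ xs∈) s zf p c
      with extend xs∈ s (λ d → zf (subst₂ (Divides _ _) refl (sym (+-assoc x (sum xs) V)) (Divides-+ʳ d (S-one x∈))))
             (λ d → p (subst₂ (Divides _ _) refl (sym (+-assoc x (sum xs) V)) (Divides-+ʳ d (S-one x∈)))) c
    ... | c′ , len = subst
      (λ V → ∃ λ (c″ : Chain P (suc (length xs + K)) V) → length (Chain.classes c″) ≡ suc (length xs + length (Chain.classes c)))
      (sym (+-assoc x (sum xs) V))
      (grow x∈ (S-+ (list⇒S xs∈) s) (subst (ZeroFree _) (+-assoc x (sum xs) V) zf)
        (subst (P _) (+-assoc x (sum xs) V) (p (Divides-refl (S-+ (sum-suc x∈ (list⇒S xs∈)) s)) (s≤s (m≤n+m K (length xs))) (m≤n+m V (x + sum xs)))) c′ ,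
       cong suc len)

    suffix-chain : {C : ℕ → ℕ → Set} → (∀ k v → Dec (C k v)) → ¬ C 0 0 → ∀ {K V} → S K V → ZeroFree K V →
      (∀ {k v} → Divides k v K V → C k v → P k v) →
      ∃ λ (c : Chain P K V) → ∃₂ λ k v → Divides k v K V × ¬ C k v × K ≡ length (Chain.classes c) + k
    suffix-chain C? ¬C00 s zf C⇒P with S⇒list s
    ... | es , es∈ , refl , refl = suffixes C? ¬C00 es∈ zf C⇒P

    -- Leaves out the whole point, because only the proper parts of the first member of a least
    -- crossing are known to avoid the classes of the second. This costs one class in the count.
    proper-suffix-chain : {C : ℕ → ℕ → Set} → (∀ k v → Dec (C k v)) → ¬ C 0 0 → ∀ {K V} → 1 ≤ K → S K V → ZeroFree K V →
      (∀ {k v} → Divides k v K V → k < K → C k v → P k v) →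
      ∃ λ (c : Chain P K V) → ∃₂ λ k v → v ≤ V × ¬ C k v × K ≡ suc (length (Chain.classes c) + k)
    proper-suffix-chain C? ¬C00 (s≤s _) (sum-suc {a = a} {x} a∈ s) zf C⇒P
      with suffix-chain C? ¬C00 s (ZeroFree-tail a∈ zf)
             (λ {k} d → C⇒P (Divides-+ʳ d (S-one a∈)) (s≤s (≤-trans (m≤m+n k _) (≤-reflexive (Divides.k+ck d)))))
    ... | c , k , v , d , ¬C , len =
      record { Chain c ; members = All.map (λ (k , v , d , h) → k , v , Divides-+ʳ d (S-one a∈) , h) (Chain.members c) } ,
      k , v , ≤-trans (m≤m+n v _) (≤-trans (≤-reflexive (Divides.v+cv d)) (m≤n+m x a)) , ¬C , cong suc len

    -- Orders the summands of the whole so that its partial sums first run through the given part.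
    extend-chain : ∀ {k v K V} → (d : Divides k v K V) → ZeroFree K V →
      (∀ {k′ v′} → Divides k′ v′ K V → suc k ≤ k′ → v ≤ v′ → P k′ v′) → (c : Chain P k v) →
      ∃ λ (c′ : Chain P K V) → length (Chain.classes c′) + k ≡ K + length (Chain.classes c)
    extend-chain {k} {v} (divides {ck} {cv} s t refl refl) zf p c with S⇒list t
    ... | gs , gs∈ , refl , refl rewrite +-comm k (length gs) | +-comm v (sum gs) with extend gs∈ s zf p c
    ...   | c′ , len = c′ , trans (cong (_+ k) len) (regroup (length gs) (length (Chain.classes c)) k)
      where
      regroup : ∀ g n k → g + n + k ≡ g + k + n
      regroup g n k = solve (g ▹ n ▹ k ▹ □)

-- Crossings of two short minimal points

module Gap (A : List ℕ) (uA : Unique A) (gcd≡1 : gcdList A ≡ 1) (l : ℕ) .{{_ : NonZero l}}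
  (0∈A : 0 ∈ A) (l∈A : l ∈ A) (A≤l : ∀ {a} → a ∈ A → a ≤ l) where

  open Sumset A l 0∈A l∈A A≤l
  open LongMinimal A uA l 0∈A l∈A A≤l using (residues; residues-unique; ∈-residues⁻; length-residues)
  open Chains A l 0∈A l∈A A≤l

  ∈-residues⁺ : ∀ {a} → a ∈ A → a % l ∈ residues
  ∈-residues⁺ {a} a∈ with a <? l
  ... | yes a<l = subst (_∈ residues) (sym (m<n⇒m%n≡m a<l)) (∈-filter⁺ (_<? l) a∈ a<l)
  ... | no a≮l = subst (_∈ residues) (sym (trans (cong (_% l) (≤-antisym (A≤l a∈) (≮⇒≥ a≮l))) (n%n≡0 l)))
    (∈-filter⁺ (_<? l) 0∈A (>-nonZero⁻¹ l))

  module D = Doubling A gcd≡1 l residues residues-unique (proj₂ ∘ ∈-residues⁻)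
    (∈-filter⁺ (_<? l) 0∈A (>-nonZero⁻¹ l)) ∈-residues⁺

  -- The point (m , x) is not in S, but its two neighbours (1+m , x) and (1+m , x+l) are;
  -- (k₀ , v₀) and (k₁ , v₁) are what remains of them after removing all copies of l, respectively of 0.
  module Corner {m x k₀ v₀ j k₁ v₁ i : ℕ} (missing : ¬ S m x)
    (S₀ : S k₀ v₀) (min₀ : Minimal k₀ v₀) (value₀ : v₀ + j * l ≡ x) (size₀ : k₀ + j ≡ suc m)
    (S₁ : S k₁ v₁) (min₁ : Minimal k₁ v₁) (value₁ : v₁ ≡ x + l) (size₁ : k₁ + i ≡ suc m)
    (1≤j : 1 ≤ j) (1≤i : 1 ≤ i) (2m+3n : 2 * l + 9 ≤ 2 * m + 3 * length A) where

    two-fold-free₀ : ∀ {k v c d} → Divides k v k₀ v₀ → 3 ≤ k → l + v < k * l → c ∈ A → d ∈ A → (c + d) % l ≢ v % l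
    two-fold-free₀ {k} {v} {c} {d} dv 3≤k below c∈ d∈ e with %-≡-cases l v (c + d) (sym e)
    ... | inj₁ (Y , v≡) with 2 + Y ≤? k
    ...   | yes h = Minimal-part min₀ dv Y (S-two c∈ d∈) (sym v≡) h 3≤k
    ...   | no h = by⊥ (below ⊕ ≤-reflexive (sym v≡) ⊕ (scale l (≤-pred (≰⇒> h)))) (c + d) (solve (l ▹ v ▹ k ▹ c ▹ d ▹ Y ▹ □))
    two-fold-free₀ {k} {v} {c} {d} (divides {ck} {cv} s t k+ v+) 3≤k below c∈ d∈ e | inj₂ (suc Y , v≡) =
      contra (A≤l c∈) (A≤l d∈) (Minimal⇒0< (Minimal-part min₀ (divides s t k+ v+)) s (≤-trans (s≤s z≤n) 3≤k))
      where
      contra : c ≤ l → d ≤ l → 0 < v → ⊥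
      contra h₁ h₂ h₃ = by⊥ (h₁ ⊕ h₂ ⊕ h₃ ⊕ ≤-reflexive (sym v≡)) (Y * l) (solve (c ▹ l ▹ d ▹ v ▹ Y ▹ □))
    two-fold-free₀ {k} {v} {c} {d} (divides {ck} {cv} s t k+ v+) 3≤k below c∈ d∈ e | inj₂ (zero , v≡) = reach j 1≤j value₀ size₀
      where
      reach : ∀ j → 1 ≤ j → v₀ + j * l ≡ x → k₀ + j ≡ suc m → ⊥
      reach (suc j′) _ h₁ h₂ = missing (S-up j′ (S-+ (S-two c∈ d∈) t) (value h₁ v+) (size h₂ k+))
        where
        value : ∀ {v₀} → v₀ + suc j′ * l ≡ x → v + cv ≡ v₀ → c + d + cv + j′ * l ≡ x
        value {v₀} h₁ h₂ = by≡ (h₁ ⊞ h₂ ⊞ v≡) (solve (v₀ ▹ j′ ▹ l ▹ x ▹ v ▹ cv ▹ c ▹ d ▹ □))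
        size : ∀ {k₀} → k₀ + suc j′ ≡ suc m → k + ck ≡ k₀ → 2 + ck + j′ ≤ m
        size {k₀} h₁ h₂ = by≤ (≤-reflexive h₁ ⊕ ≤-reflexive h₂ ⊕ 3≤k) 1 (solve (k₀ ▹ j′ ▹ m ▹ k ▹ ck ▹ □))

    -- The mirror image: a value above `l` excludes c + d > v, and minimality excludes v = c + d +
    -- Y*l except for Y = k - 1. In that case one copy of `l` is dropped, turning x + l into x, and
    -- i ≥ 1 makes the result fit into m summands.
    two-fold-free₁ : ∀ {k v c d} → Divides k v k₁ v₁ → 3 ≤ k → l < v → c ∈ A → d ∈ A → (c + d) % l ≢ v % l
    two-fold-free₁ {k} {v} {c} {d} dv@(divides {ck} {cv} s t k+ v+) 3≤k above c∈ d∈ e with %-≡-cases l v (c + d) (sym e)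
    ... | inj₂ (Y , v≡) = contra (A≤l c∈) (A≤l d∈)
      where
      contra : c ≤ l → d ≤ l → ⊥
      contra h₁ h₂ = by⊥ (h₁ ⊕ h₂ ⊕ above ⊕ ≤-reflexive (sym v≡)) (Y * l) (solve (c ▹ l ▹ d ▹ v ▹ Y ▹ □))
    ... | inj₁ (Y , v≡) with 2 + Y ≤? k
    ...   | yes h = Minimal-part min₁ dv Y (S-two c∈ d∈) (sym v≡) h 3≤k
    ...   | no h with Y
    ...     | zero = ⊥-elim (h (≤-trans (n≤1+n 2) 3≤k))
    ...     | suc Y′ = missing (S-up Y′ (S-+ (S-two c∈ d∈) t) (value value₁ v+) (size size₁ k+ k≥))
      where
      k≥ : suc (suc Y′) ≤ k
      k≥ = *-cancelʳ-< l (suc Y′) k (≤-<-trans (≤-trans (m≤n+m (suc Y′ * l) (c + d)) (≤-reflexive (sym v≡)))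
        (Minimal⇒<k*l (Minimal-part min₁ dv) s (≤-trans (s≤s z≤n) 3≤k)))
      value : ∀ {v₁} → v₁ ≡ x + l → v + cv ≡ v₁ → c + d + cv + Y′ * l ≡ x
      value {v₁} h₁ h₂ = by≡ (h₁ ⊞ h₂ ⊞ (sym v≡)) (solve (v₁ ▹ x ▹ l ▹ v ▹ cv ▹ c ▹ d ▹ Y′ ▹ □))
      size : ∀ {k₁} → k₁ + i ≡ suc m → k + ck ≡ k₁ → suc (suc Y′) ≤ k → 2 + ck + Y′ ≤ m
      size {k₁} h₁ h₂ h₃ = by≤ (≤-reflexive h₁ ⊕ ≤-reflexive h₂ ⊕ h₃ ⊕ 1≤i) 0 (solve (k₁ ▹ i ▹ m ▹ k ▹ ck ▹ Y′ ▹ □))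

    -- Counted as (number of zeros , number of copies of l), e and f differ by (X , - y) with X, y ≥ 1.
    -- A crossing of least size κ makes the proper partial sums of e incongruent to those of f.
    record Crossing (κ : ℕ) : Set where
      field
        {ve kf vf y} : ℕ
        e : Divides κ ve k₀ v₀
        f : Divides kf vf k₁ v₁
        congruent : ve + y * l ≡ vf
        1≤y : 1 ≤ y
        exceeds : kf + 1 ≤ κ + y

    whole : Crossing k₀
    whole = record { e = Divides-refl S₀ ; f = Divides-refl S₁ ; y = suc j ; congruent = value value₀ value₁
                   ; 1≤y = s≤s z≤n ; exceeds = size size₀ size₁ }
      where
      value : ∀ {v₀ v₁} → v₀ + j * l ≡ x → v₁ ≡ x + l → v₀ + suc j * l ≡ v₁
      value {v₀} {v₁} h₁ h₂ = by≡ (h₁ ⊞ (sym h₂)) (solve (v₀ ▹ j ▹ l ▹ x ▹ v₁ ▹ □))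
      size : ∀ {k₀ k₁} → k₀ + j ≡ suc m → k₁ + i ≡ suc m → k₁ + 1 ≤ k₀ + suc j
      size {k₀} {k₁} h₁ h₂ = by≤ (≤-reflexive (sym h₁) ⊕ ≤-reflexive h₂) i (solve (k₀ ▹ j ▹ m ▹ k₁ ▹ i ▹ □))

    Divides-co : ∀ {k v K V} (d : Divides k v K V) → Divides (Divides.ck d) (Divides.cv d) K V
    Divides-co {k} {v} (divides {ck} {cv} s t e₁ e₂) = divides t s (trans (+-comm ck k) e₁) (trans (+-comm cv v) e₂)

    module Descent {κ ve kf vf y : ℕ} (ih : ∀ {κ′} → κ′ < κ → Crossing κ′ → ⊥)
      (e : Divides κ ve k₀ v₀) (f : Divides kf vf k₁ v₁)
      (congruent : ve + y * l ≡ vf) (1≤y : 1 ≤ y) (exceeds : kf + 1 ≤ κ + y) where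

      -- Otherwise exchanging f for e and y - 1 copies of `l` inside (k₁ , v₁) would reach (m , x).
      -- This gains over `exceeds` the i zeros stripped from the second point, which restore the
      -- size 1+m in the final count.
      exceeds-i : kf + 1 + i ≤ κ + y
      exceeds-i = ≮⇒≥ λ short → reach y 1≤y congruent short f
        where
        reach : ∀ y → 1 ≤ y → ve + y * l ≡ vf → κ + y < kf + 1 + i → Divides kf vf k₁ v₁ → ⊥
        reach (suc y′) _ h₁ h₂ (divides {ck} {cv} _ t k+ v+) =
          missing (S-up y′ (S-+ (Divides.part e) t) (value value₁ v+) (size size₁ k+))
          where
          value : ∀ {v₁} → v₁ ≡ x + l → vf + cv ≡ v₁ → ve + cv + y′ * l ≡ x
          value {v₁} h₃ h₄ = by≡ (h₁ ⊞ h₃ ⊞ h₄) (solve (ve ▹ y′ ▹ l ▹ vf ▹ v₁ ▹ x ▹ cv ▹ □))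
          size : ∀ {k₁} → k₁ + i ≡ suc m → kf + ck ≡ k₁ → κ + ck + y′ ≤ m
          size {k₁} h₃ h₄ = by≤ (h₂ ⊕ ≤-reflexive h₃ ⊕ ≤-reflexive h₄) 0 (solve (κ ▹ y′ ▹ kf ▹ i ▹ k₁ ▹ m ▹ ck ▹ □))

      -- Position of a partial sum on a path through f. Beyond f only the value is recorded, since
      -- it already exceeds every part of e.
      Inside : ℕ → ℕ → Set
      Inside k v = Divides k v kf vf ⊎ vf ≤ v

      -- If v′ is larger, the two parts themselves form a smaller crossing, or exchanging them
      -- reaches (m , x). If v is at least v′, exchanging them contradicts the minimality of (k₀ ,
      -- v₀), or the complements in e and f form a smaller crossing; beyond f this second case is
      -- impossible by value.
      coincidence-free : ∀ {k v k′ v′} → Divides k v κ ve → 1 ≤ k → k < κ → Divides k′ v′ k₁ v₁ → Inside k′ v′ →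
        v % l ≢ v′ % l
      coincidence-free {k} {v} {k′} {v′} dv 1≤k k<κ dv′ inside eq with %-≡-cases l v v′ eq
      ... | inj₂ (Y , v′≡) with k′ + 1 ≤? k + suc Y
      ...   | yes crosses = ih k<κ record
          { e = Divides-trans dv e ; f = dv′ ; y = suc Y ; congruent = sym v′≡ ; 1≤y = s≤s z≤n ; exceeds = crosses }
      ...   | no short with dv′
      ...     | divides {ck} {cv} _ t k+ v+ = missing (S-up Y (S-+ (Divides.part dv) t) (value value₁ v+) (size size₁ k+ (≰⇒> short)))
        where
        value : ∀ {v₁} → v₁ ≡ x + l → v′ + cv ≡ v₁ → v + cv + Y * l ≡ x
        value {v₁} h₁ h₂ = by≡ (h₁ ⊞ h₂ ⊞ (sym v′≡)) (solve (v₁ ▹ x ▹ l ▹ v′ ▹ cv ▹ v ▹ Y ▹ □))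
        size : ∀ {k₁} → k₁ + i ≡ suc m → k′ + ck ≡ k₁ → k + suc Y < k′ + 1 → k + ck + Y ≤ m
        size {k₁} h₁ h₂ h₃ = by≤ (≤-reflexive h₁ ⊕ ≤-reflexive h₂ ⊕ h₃) i (solve (k₁ ▹ i ▹ m ▹ k′ ▹ ck ▹ k ▹ Y ▹ □))
      coincidence-free {k} {v} {k′} {v′} dv 1≤k k<κ dv′ inside eq | inj₁ (Y , v≡) with suc (k′ + Y) ≤? k
      ... | yes smaller with Divides-trans dv e
      ...   | divides {ck} {cv} _ t k+ v+ = min₀ Y (S-+ (Divides.part dv′) t) (value v+) (size k+) (size′ k+)
        where
        value : ∀ {v₀} → v + cv ≡ v₀ → v′ + cv + Y * l ≡ v₀
        value {v₀} h = by≡ (h ⊞ (sym v≡)) (solve (v ▹ cv ▹ v₀ ▹ v′ ▹ Y ▹ l ▹ □))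
        size : ∀ {k₀} → k + ck ≡ k₀ → k′ + ck + Y ≤ k₀
        size {k₀} h = by≤ (≤-reflexive h ⊕ smaller) 1 (solve (k ▹ ck ▹ k₀ ▹ k′ ▹ Y ▹ □))
        size′ : ∀ {k₀} → k + ck ≡ k₀ → k′ + ck < k₀
        size′ {k₀} h = by≤ (≤-reflexive h ⊕ smaller) Y (solve (k ▹ ck ▹ k₀ ▹ k′ ▹ Y ▹ □))
      coincidence-free {k} {v} {k′} {v′} (divides {ck} {cv} s t k+ v+) 1≤k k<κ dv′ (inj₂ vf≤v′) eq | inj₁ (Y , v≡) | no _ =
        contra congruent v+ (scale l 1≤y) (>-nonZero⁻¹ l)
        where
        contra : ∀ {ve} → ve + y * l ≡ vf → v + cv ≡ ve → 1 * l ≤ y * l → 0 < l → ⊥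
        contra {ve} h₁ h₂ h₃ h₄ =
          by⊥ (≤-reflexive h₁ ⊕ ≤-reflexive h₂ ⊕ h₃ ⊕ h₄ ⊕ vf≤v′ ⊕ ≤-reflexive (sym v≡)) (Y * l + cv)
            (solve (ve ▹ y ▹ l ▹ vf ▹ v ▹ cv ▹ v′ ▹ Y ▹ □))
      coincidence-free {k} {v} {k′} {v′} dv@(divides {ck} {cv} s t k+ v+) 1≤k k<κ dv′
        (inj₁ dvf@(divides {ck′} {cv′} _ _ k+′ v+′)) eq | inj₁ (Y , v≡) | no short =
        ih (≤-trans (+-monoˡ-≤ ck 1≤k) (≤-reflexive k+)) record
          { e = Divides-trans (Divides-co dv) e ; f = Divides-trans (Divides-co dvf) f ; y = Y + y
          ; congruent = value congruent v+ v+′ ; 1≤y = ≤-trans 1≤y (m≤n+m y Y) ; exceeds = size exceeds k+ k+′ (≰⇒> short) }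
        where
        value : ∀ {ve vf} → ve + y * l ≡ vf → v + cv ≡ ve → v′ + cv′ ≡ vf → cv + (Y + y) * l ≡ cv′
        value {ve} {vf} h₁ h₂ h₃ = by≡ (h₁ ⊞ h₂ ⊞ (sym h₃) ⊞ (sym v≡)) (solve (ve ▹ y ▹ l ▹ vf ▹ v ▹ cv ▹ v′ ▹ cv′ ▹ Y ▹ □))
        size : ∀ {κ kf} → kf + 1 ≤ κ + y → k + ck ≡ κ → k′ + ck′ ≡ kf → k < suc (k′ + Y) → ck′ + 1 ≤ ck + (Y + y)
        size {κ} {kf} h₁ h₂ h₃ h₄ =
          by≤ (h₁ ⊕ ≤-reflexive (sym h₂) ⊕ ≤-reflexive h₃ ⊕ h₄) 0 (solve (kf ▹ κ ▹ y ▹ k ▹ ck ▹ k′ ▹ ck′ ▹ Y ▹ □))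

      private
        mine = Minimal-part min₀ e
        minf = Minimal-part min₁ f
        Sf = Divides.part f

      -- From y*l ≤ vf < kf*l one gets y < kf, and `exceeds-i` turns this into room on the side of
      -- e. It later ensures that some class lies outside A + A.
      i<κ : suc (suc i) ≤ κ
      i<κ = combine y<kf
        where
        y<kf : y < kf
        y<kf = *-cancelʳ-< l y kf (≤-<-trans (≤-trans (m≤n+m (y * l) ve) (≤-reflexive congruent)) vf<kf*l)
          where
          1≤kf : 1 ≤ kf
          1≤kf = n≢0⇒n>0 λ kf≡0 → contra (subst (λ k → vf ≤ k * l) kf≡0 (S-≤ Sf)) (scale l 1≤y) (>-nonZero⁻¹ l)
            where
            contra : vf ≤ 0 → 1 * l ≤ y * l → 0 < l → ⊥
            contra h₁ h₂ h₃ = by⊥ (h₁ ⊕ h₂ ⊕ h₃ ⊕ ≤-reflexive congruent) ve (solve (vf ▹ l ▹ y ▹ ve ▹ □))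
          vf<kf*l : vf < kf * l
          vf<kf*l = Minimal⇒<k*l minf Sf 1≤kf
        combine : y < kf → suc (suc i) ≤ κ
        combine h = by≤ (h ⊕ exceeds-i) 0 (solve (y ▹ kf ▹ i ▹ κ ▹ □))

      0<ve : 0 < ve
      0<ve = Minimal⇒0< mine (Divides.part e) (≤-trans (s≤s z≤n) i<κ)

      l<vf : l < vf
      l<vf = combine (scale l 1≤y)
        where
        combine : 1 * l ≤ y * l → l < vf
        combine h = by≤ (h ⊕ 0<ve ⊕ ≤-reflexive congruent) 0 (solve (l ▹ y ▹ ve ▹ vf ▹ □))

      2≤kf : 2 ≤ kf
      2≤kf = *-cancelʳ-< l 1 kf (≤-trans (s≤s (≤-trans (≤-reflexive (+-identityʳ l)) (<⇒≤ l<vf)))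
               (Minimal⇒<k*l minf Sf (n≢0⇒n>0 λ kf≡0 → <⇒≱ l<vf (≤-trans (subst (λ k → vf ≤ k * l) kf≡0 (S-≤ Sf)) z≤n))))

      -- Parts satisfying E, resp. F, have their class outside A + A.
      E F : ℕ → ℕ → Set
      E k v = 3 ≤ k × l + v < k * l
      F k v = 3 ≤ k × l < v

      E? : ∀ k v → Dec (E k v)
      E? k v = (3 ≤? k) ×-dec (l + v <? k * l)

      F? : ∀ k v → Dec (F k v)
      F? k v = (3 ≤? k) ×-dec (l <? v)

      E-member F-member : ℕ → ℕ → Set
      E-member k v = E k v × Divides k v κ ve × k < κ
      F-member k v = F k v × Divides k v k₁ v₁ × Inside k v

      private
        -- Kept multiplied by `l`: when it is added to the bound for F, the values ve and vf cancel
        -- through `congruent` up to y*l, and only then is `l` divided out.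
        ¬E-bound : ∀ {k v} → ¬ E k v → v ≤ ve → k * l < 2 * l + ve
        ¬E-bound {k} {v} ¬E v≤ with 3 ≤? k
        ... | no k≱3 = combine (scale l (≤-pred (≰⇒> k≱3)))
          where
          combine : k * l ≤ 2 * l → k * l < 2 * l + ve
          combine h = by≤ (h ⊕ 0<ve) 0 (solve (k ▹ l ▹ ve ▹ □))
        ... | yes 3≤k = combine (≮⇒≥ λ h → ¬E (3≤k , h)) (>-nonZero⁻¹ l)
          where
          combine : k * l ≤ l + v → 0 < l → k * l < 2 * l + ve
          combine h h′ = by≤ (h ⊕ h′ ⊕ v≤) 0 (solve (k ▹ l ▹ v ▹ ve ▹ □))

        ¬F-bound : ∀ {k v} → ¬ F k v → Divides k v kf vf → k * l + vf < 2 * l + kf * l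
        ¬F-bound {k} {v} ¬F (divides {ck} {cv} _ t k+ v+) with 3 ≤? k
        ... | no k≱3 = combine (scale l (≤-pred (≰⇒> k≱3))) (Minimal⇒<k*l minf Sf (<⇒≤ 2≤kf))
          where
          combine : k * l ≤ 2 * l → vf < kf * l → k * l + vf < 2 * l + kf * l
          combine h h′ = by≤ (h ⊕ h′) 0 (solve (k ▹ l ▹ vf ▹ kf ▹ □))
        ... | yes 3≤k = combine k+ v+ (≮⇒≥ λ h → ¬F (3≤k , h)) (S-≤ t) (>-nonZero⁻¹ l)
          where
          combine : ∀ {kf vf} → k + ck ≡ kf → v + cv ≡ vf → v ≤ l → cv ≤ ck * l → 0 < l → k * l + vf < 2 * l + kf * l
          combine {_} {vf} refl h₁ h₂ h₃ h₄ =
            by≤ (≤-reflexive (sym h₁) ⊕ h₂ ⊕ h₃ ⊕ h₄) 0 (solve (v ▹ cv ▹ vf ▹ l ▹ ck ▹ k ▹ □))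

      record EChain : Set where
        field
          chain : Chain E-member κ ve
          {k} : ℕ
          bound : k * l < 2 * l + ve
          count : κ ≡ suc (length (Chain.classes chain) + k)

      e-chain : EChain
      e-chain with proper-suffix-chain E? (λ { (() , _) }) (≤-trans (s≤s z≤n) i<κ) (Divides.part e) (Minimal⇒ZeroFree mine)
                     (λ d k<κ h → h , d , k<κ)
      ... | c , k , v , v≤ , ¬C , len = record { chain = c ; bound = ¬E-bound ¬C v≤ ; count = len }

      record FChain : Set where
        field
          chain : Chain F-member k₁ v₁
          {k} : ℕ
          bound : k * l + vf < 2 * l + kf * l
          count : k₁ ≡ length (Chain.classes chain) + k

      f-chain : FChain
      f-chain with suffix-chain {P = F-member} F? (λ { (() , _) }) Sf (Minimal⇒ZeroFree minf) (λ d h → h , Divides-trans d f , inj₁ d)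
      ... | c , k , v , d , ¬C , len
        -- Beyond f every partial sum satisfies F: it has at least 3 summands as 2 ≤ kf, and its
        -- value is above `l` as l < vf.
        with extend-chain f (Minimal⇒ZeroFree min₁) (λ d kf<k vf≤v → (≤-trans (s≤s 2≤kf) kf<k , ≤-trans l<vf vf≤v) , d , inj₂ vf≤v) c
      ...   | c′ , len′ = record
        { chain = c′
        ; bound = ¬F-bound ¬C d
        ; count = combine len len′ }
        where
        combine : ∀ {kf n n′} → kf ≡ n + k → n′ + kf ≡ k₁ + n → k₁ ≡ n′ + k
        combine {kf} {n} {n′} h₁ h₂ = by≡ (h₁ ⊞ (sym h₂)) (solve (kf ▹ n ▹ k ▹ n′ ▹ k₁ ▹ □))

      count-classes : EChain → FChain → ⊥
      count-classes ec fc = combine (EChain.count ec) (FChain.count fc)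
          (*-cancelʳ-< l _ _ (cancelled (EChain.k ec) (FChain.k fc) (EChain.bound ec) (FChain.bound fc)))
        where
        module EC = Chain (EChain.chain ec)
        module FC = Chain (FChain.chain fc)
        -- The two discarded ends thus satisfy k + k′ ≤ kf + 3 - y, and `exceeds-i` then leaves at
        -- least k₁ + i - 3 = m - 2 classes.
        cancelled : ∀ k k′ → k * l < 2 * l + ve → k′ * l + vf < 2 * l + kf * l → (k + k′ + y) * l < (4 + kf) * l
        cancelled k k′ h₁ h₂ = by≤ (h₁ ⊕ h₂ ⊕ ≤-reflexive congruent) 1 (solve (k ▹ l ▹ ve ▹ k′ ▹ vf ▹ kf ▹ y ▹ □))
        e-new : ∀ {z} → z ∈ EC.classes → D.TwoB z → ⊥
        e-new z∈ two with All.lookup EC.members z∈ | find two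
        ... | k , v , _ , ((3≤k , h) , d , _) , refl | c , c∈ , two′ with find two′
        ...   | c′ , c′∈ , eq = two-fold-free₀ (Divides-trans d e) 3≤k h (proj₁ (∈-residues⁻ c∈)) (proj₁ (∈-residues⁻ c′∈)) eq
        f-new : ∀ {z} → z ∈ FC.classes → D.TwoB z → ⊥
        f-new z∈ two with All.lookup FC.members z∈ | find two
        ... | k , v , _ , ((3≤k , h) , d , _) , refl | c , c∈ , two′ with find two′
        ...   | c′ , c′∈ , eq = two-fold-free₁ d 3≤k h (proj₁ (∈-residues⁻ c∈)) (proj₁ (∈-residues⁻ c′∈)) eq
        disjoint : ∀ {z} → z ∈ EC.classes × z ∈ FC.classes → ⊥
        disjoint (z∈ , z∈′) with All.lookup EC.members z∈ | All.lookup FC.members z∈′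
        ... | k , v , _ , ((3≤k , _) , d , k<κ) , refl | _ , _ , _ , (_ , d′ , inside) , eq =
          coincidence-free d (≤-trans (s≤s z≤n) 3≤k) k<κ d′ inside eq
        e-below : ∀ {z} → z ∈ EC.classes → z < l
        e-below z∈ with All.lookup EC.members z∈
        ... | _ , v , _ , _ , refl = m%n<n v l
        f-below : ∀ {z} → z ∈ FC.classes → z < l
        f-below z∈ with All.lookup FC.members z∈
        ... | _ , v , _ , _ , refl = m%n<n v l
        new : List ℕ
        new = EC.classes ++ FC.classes
        new-off-D : ∀ {z} → z ∈ new → D.TwoB z → ⊥
        new-off-D z∈ = [ e-new , f-new ]′ (∈-++⁻ EC.classes z∈)
        new-below : ∀ {z} → z ∈ new → z < l
        new-below z∈ = [ e-below , f-below ]′ (∈-++⁻ EC.classes z∈)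
        ∈D⁻ : ∀ {z} → z ∈ D.D → z < l × D.TwoB z
        ∈D⁻ z∈ with ∈-filter⁻ D.twoB? {xs = upTo l} z∈
        ... | z∈′ , two = ∈-upTo⁻ z∈′ , two
        total : length EC.classes + length FC.classes + length D.D ≤ l
        total = ≤-trans (≤-reflexive (sym (trans (length-++ new) (cong (_+ length D.D) (length-++ EC.classes)))))
          (unique-bounded (Uniqueₚ.++⁺ (Uniqueₚ.++⁺ EC.unique FC.unique disjoint) (Uniqueₚ.filter⁺ D.twoB? (Uniqueₚ.upTo⁺ l))
              (λ (z∈ , z∈D) → new-off-D z∈ (proj₂ (∈D⁻ z∈D))))
            ([ new-below , proj₁ ∘ ∈D⁻ ]′ ∘ ∈-++⁻ new))
        3n≤2∣D∣ : 0 < length new → 3 * length residues ≤ 2 * length D.D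
        3n≤2∣D∣ 0<new with new in eq
        ... | z ∷ _ = D.missing⇒3n≤2∣D∣ (new-below z∈) (new-off-D z∈)
          where
          z∈ : z ∈ new
          z∈ = subst (z ∈_) (sym eq) (here refl)
        κ≤k₀ : κ ≤ k₀
        κ≤k₀ = ≤-trans (m≤m+n κ _) (≤-reflexive (Divides.k+ck e))
        combine : ∀ {k k′} → κ ≡ suc (length EC.classes + k) → k₁ ≡ length FC.classes + k′ → k + k′ + y < 4 + kf → ⊥
        combine {k} {k′} h₁ h₂ h₃ = contra (length A) (length residues) (length EC.classes) (length FC.classes) (length D.D) h₁ h₂
            2m+3n length-residues total
            (3n≤2∣D∣ (≤-trans (nonempty (length EC.classes) (length FC.classes) h₁ h₂)
              (≤-reflexive (sym (length-++ EC.classes)))))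
          where
          -- The 3/2 bound needs a class outside A + A. There is one because a + b ≥ m - 2 and m ≥
          -- k₀ ≥ κ ≥ i + 2 ≥ 3.
          nonempty : ∀ a b → κ ≡ suc (a + k) → k₁ ≡ b + k′ → 0 < a + b
          nonempty a b h₁ h₂ =
            by≤ (≤-reflexive h₁ ⊕ ≤-reflexive h₂ ⊕ h₃ ⊕ exceeds-i ⊕ ≤-reflexive (sym size₁) ⊕ ≤-reflexive size₀ ⊕
              κ≤k₀ ⊕ 1≤j ⊕ 1≤i ⊕ i<κ) 0
              (solve (κ ▹ a ▹ k ▹ k₁ ▹ b ▹ k′ ▹ y ▹ kf ▹ i ▹ m ▹ k₀ ▹ j ▹ □))
          -- From a + b ≥ m - 2, d ≥ 3(n-1)/2 and a + b + d ≤ l follows 2m + 3n ≤ 2l + 7.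
          contra : ∀ n r a b d → κ ≡ suc (a + k) → k₁ ≡ b + k′ → 2 * l + 9 ≤ 2 * m + 3 * n → n ≤ suc r → a + b + d ≤ l → 3 * r ≤ 2 * d → ⊥
          contra n r a b d h₁ h₂ h₄ h₅ h₆ h₇ =
            by⊥ (2 ⊗ (≤-reflexive h₁) ⊕ 2 ⊗ (≤-reflexive h₂) ⊕ 2 ⊗ h₃ ⊕ 2 ⊗ exceeds-i ⊕ 2 ⊗ (≤-reflexive (sym size₁)) ⊕
              h₄ ⊕ 3 ⊗ h₅ ⊕ 2 ⊗ h₆ ⊕ h₇) 1
              (solve (κ ▹ a ▹ k ▹ k₁ ▹ b ▹ k′ ▹ y ▹ kf ▹ i ▹ m ▹ l ▹ n ▹ r ▹ d ▹ □))

      impossible : ⊥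
      impossible = count-classes e-chain f-chain

    no-crossing : ∀ κ → Crossing κ → ⊥
    no-crossing = <-rec (λ κ → Crossing κ → ⊥) λ κ ih c → let open Crossing c in
      Descent.impossible (λ κ′<κ → ih κ′<κ) e f congruent 1≤y exceeds

    contradiction : ⊥
    contradiction = no-crossing k₀ whole

-- The exceptional family

-- Meant for T = l - (A ∩ (1 , l)): it shows that a point missing from mA is not accounted for by
-- the exceptional set of l - A.
module Dense (C T : List ℕ) (L : ℕ) (uT : Unique T) (T⊆C : ∀ {c} → c ∈ T → c ∈ C)
  (1≤T : ∀ {c} → c ∈ T → 1 ≤ c) (T≤L : ∀ {c} → c ∈ T → c ≤ L) (dense : 2 * L + 4 ≤ 3 * length T) where

  private
    N = length T

  -- N numbers up to L cannot all lie among the top N - 1. Subtracting this c from any z > L leaves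
  -- at least N, as the induction in `representable` requires.
  small-element : ∃ λ c → c ∈ T × c + N ≤ L + 1
  small-element with any? (λ c → c + N ≤? L + 1) T
  ... | yes found = find found
  ... | no none = ⊥-elim (size N (subst (N ≤_) (trans (length-map (L ∸_) (upTo (N ∸ 1))) (length-upTo (N ∸ 1)))
                    (unique-⊆⇒length≤ uT top)) dense)
    where
    size : ∀ N → N ≤ N ∸ 1 → 2 * L + 4 ≤ 3 * N → ⊥
    size zero _ h rewrite +-comm (2 * L) 4 = <⇒≱ h z≤n
    size (suc N) h _ = <⇒≱ h ≤-refl
    top : ∀ {c} → c ∈ T → c ∈ map (L ∸_) (upTo (N ∸ 1))
    top {c} c∈ = subst (_∈ map (L ∸_) (upTo (N ∸ 1))) (m∸[m∸n]≡n (T≤L c∈))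
      (∈-map⁺ (L ∸_) (∈-upTo⁺ (m+n≤o⇒m≤o∸n (suc (L ∸ c)) (bound N (m∸n+n≡m (T≤L c∈)) (≰⇒> λ h → none (lose c∈ h))))))
      where
      bound : ∀ N {t} → t + c ≡ L → L + 1 < c + N → suc t + 1 ≤ N
      bound N {t} h₁ h₂ = by≤ (≤-reflexive h₁ ⊕ h₂) 0 (solve (t ▹ c ▹ L ▹ N ▹ □))

  -- If z were not a sum of at most two elements of T, then c ↦ z - c would map T ∩ [0,z] off itself.
  within-range : ∀ {z} → N ≤ z → z ≤ L → Representable C z
  within-range {z} N≤z z≤L with any? (λ c → any? (λ d → c + d ≟ z) T) T | any? (λ c → c ≟ z) T
  ... | yes found | _ with find found
  ...   | c , c∈ , found′ with find found′
  ...     | d , d∈ , refl = subst (λ d → Representable C (c + d)) (+-identityʳ d) (rep-add (T⊆C c∈) (rep-add (T⊆C d∈) rep-zero))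
  within-range {z} N≤z z≤L | no _ | yes found with find found
  ... | c , c∈ , refl = subst (Representable C) (+-identityʳ c) (rep-add (T⊆C c∈) rep-zero)
  within-range {z} N≤z z≤L | no none | no _ =
    ⊥-elim (combine N (length low) split folded (m+[n∸m]≡n z≤L) N≤z dense)
    where
    low : List ℕ
    low = filter (_≤? z) T
    ∈low : ∀ {c} → c ∈ low → c ∈ T × c ≤ z
    ∈low = ∈-filter⁻ (_≤? z)
    ulow : Unique low
    ulow = Uniqueₚ.filter⁺ (_≤? z) uT
    disjoint : ∀ {w} → w ∈ low × w ∈ map (z ∸_) low → ⊥
    disjoint {w} (w∈ , w∈′) with ∈-map⁻ (z ∸_) w∈′
    ... | c , c∈ , refl = none (lose (proj₁ (∈low c∈)) (lose (proj₁ (∈low w∈)) (m+[n∸m]≡n (proj₂ (∈low c∈)))))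
    flipped : ∀ {w} → w ∈ map (z ∸_) low → w ≤ z
    flipped w∈ with ∈-map⁻ (z ∸_) w∈
    ... | c , _ , refl = m∸n≤m z c
    folded : length low + length low ≤ suc z
    folded = ≤-trans (≤-reflexive (sym (trans (length-++ low) (cong (length low +_) (length-map (z ∸_) low)))))
      (unique-bounded (Uniqueₚ.++⁺ ulow
          (map-unique (λ c∈ d∈ → ∸-cancelˡ-≡ (proj₂ (∈low c∈)) (proj₂ (∈low d∈))) ulow) disjoint)
        (s≤s ∘ [ proj₂ ∘ ∈low , flipped ]′ ∘ ∈-++⁻ low))
    high : List ℕ
    high = map (suc z +_) (upTo (L ∸ z))
    cover : ∀ {c} → c ∈ T → c ∈ low ++ high
    cover {c} c∈ with c ≤? z
    ... | yes c≤z = ∈-++⁺ˡ (∈-filter⁺ (_≤? z) c∈ c≤z)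
    ... | no c≰z = ∈-++⁺ʳ low (subst (_∈ high) (m+[n∸m]≡n (≰⇒> c≰z))
      (∈-map⁺ (suc z +_) (∈-upTo⁺ (∸-monoˡ-< (s≤s (T≤L c∈)) (≰⇒> c≰z)))))
    split : N ≤ length low + (L ∸ z)
    split = ≤-trans (unique-⊆⇒length≤ uT cover) (≤-reflexive (trans (length-++ low)
      (cong (length low +_) (trans (length-map (suc z +_) (upTo (L ∸ z))) (length-upTo (L ∸ z))))))
    combine : ∀ N w {t} → N ≤ w + t → w + w ≤ suc z → z + t ≡ L → N ≤ z → 2 * L + 4 ≤ 3 * N → ⊥
    combine N w {t} h₁ h₂ h₃ h₄ h₅ = by⊥ (2 ⊗ h₁ ⊕ h₂ ⊕ 2 ⊗ (≤-reflexive h₃) ⊕ h₄ ⊕ h₅) 2 (solve (N ▹ w ▹ t ▹ z ▹ L ▹ □))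

  representable : ∀ z → N ≤ z → Representable C z
  representable = <-rec _ step
    where
    step : ∀ z → (∀ {w} → w < z → N ≤ w → Representable C w) → N ≤ z → Representable C z
    step z ih N≤z with z ≤? L | small-element
    ... | yes z≤L | _ = within-range N≤z z≤L
    ... | no z≰L | c , c∈ , c≤ = subst (Representable C) (m+[n∸m]≡n c≤z)
      (rep-add (T⊆C c∈) (ih (∸-monoʳ-< (1≤T c∈) c≤z) (m+n≤o⇒m≤o∸n N
        (≤-trans (≤-reflexive (+-comm N c)) (≤-trans c≤ (≤-trans (≤-reflexive (+-comm L 1)) (≰⇒> z≰L)))))))
      where
      c≤z : c ≤ z
      c≤z = ≤-trans (T≤L c∈) (<⇒≤ (≰⇒> z≰L))

module Obstruction (A : List ℕ) (uA : Unique A) (l : ℕ) (A≤l : ∀ {a} → a ∈ A → a ≤ l) (6≤n : 6 ≤ length A) (m : ℕ)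
  (2m+3n : 2 * l + 9 ≤ 2 * m + 3 * length A) (3m+2n : 2 * l + 4 ≤ 3 * m + 2 * length A)
  (dichotomy : ∀ a → a ∈ A → (a ≤ 1) ⊎ ((m + 2 ≤ a) × (a ≤ l))) where

  -- Without a summand of at least m + 2, all summands are 0 or 1. So m-fold sums jump over the
  -- value 1+m.
  sumset-dichotomy : ∀ {k v} → InSumset A k v → v ≤ k ⊎ m + 2 ≤ v
  sumset-dichotomy sum-zero = inj₁ z≤n
  sumset-dichotomy (sum-suc {a = a} {x} a∈ s) with dichotomy a a∈ | sumset-dichotomy s
  ... | inj₂ (h , _) | _ = inj₂ (≤-trans h (m≤m+n a x))
  ... | inj₁ _ | inj₂ h = inj₂ (≤-trans h (m≤n+m x a))
  ... | inj₁ h | inj₁ h′ = inj₁ (+-mono-≤ h h′)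

  1+m∉mA : ¬ InSumset A m (suc m)
  1+m∉mA s with sumset-dichotomy s
  ... | inj₁ h = <⇒≱ h ≤-refl
  ... | inj₂ h = <-irrefl refl (≤-trans (≤-reflexive (+-comm 2 m)) h)

  Middle : ℕ → Set
  Middle a = 1 < a × a < l

  middle? : Decidable Middle
  middle? a = (1 <? a) ×-dec (a <? l)

  middle : List ℕ
  middle = filter middle? A

  ∈middle : ∀ {a} → a ∈ middle → (m + 2 ≤ a) × a < l × a ∈ A
  ∈middle a∈ with ∈-filter⁻ middle? a∈
  ... | a∈A , 1<a , a<l with dichotomy _ a∈A
  ...   | inj₁ a≤1 = ⊥-elim (<⇒≱ 1<a a≤1)
  ...   | inj₂ (h , _) = h , a<l , a∈A

  n≤3+∣middle∣ : length A ≤ 3 + length middle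
  n≤3+∣middle∣ = unique-⊆⇒length≤ uA into
    where
    into : ∀ {a} → a ∈ A → a ∈ 0 ∷ 1 ∷ l ∷ middle
    into {zero} _ = here refl
    into {suc zero} _ = there (here refl)
    into {suc (suc a)} a∈ with suc (suc a) <? l
    ... | yes a<l = there (there (there (∈-filter⁺ middle? a∈ (s≤s (s≤s z≤n) , a<l))))
    ... | no a≮l = there (there (here (≤-antisym (A≤l a∈) (≮⇒≥ a≮l))))

  m+2≤l : m + 2 ≤ l
  m+2≤l with middle in eq
  ... | [] = ⊥-elim (<⇒≱ 6≤n (≤-trans n≤3+∣middle∣ (≤-trans (≤-reflexive (cong (λ xs → 3 + length xs) eq)) (m≤m+n 3 2))))
  ... | a ∷ _ with ∈middle (subst (a ∈_) (sym eq) (here refl))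
  ...   | h , a<l , _ = ≤-trans h (<⇒≤ a<l)

  private
    L = l ∸ (m + 2)

    L+m+2≡l : L + (m + 2) ≡ l
    L+m+2≡l = m∸n+n≡m m+2≤l

    T : List ℕ
    T = map (l ∸_) middle

    ∈T : ∀ {c} → c ∈ T → ∃ λ a → a ∈ middle × c + a ≡ l × c ≡ l ∸ a
    ∈T c∈ with ∈-map⁻ (l ∸_) c∈
    ... | a , a∈ , refl = a , a∈ , m∸n+n≡m (<⇒≤ (proj₁ (proj₂ (∈middle a∈)))) , refl

    uT : Unique T
    uT = map-unique (λ a∈ b∈ → ∸-cancelˡ-≡ (below a∈) (below b∈)) (Uniqueₚ.filter⁺ middle? uA)
      where
      below : ∀ {a} → a ∈ middle → a ≤ l
      below a∈ = <⇒≤ (proj₁ (proj₂ (∈middle a∈)))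

    T⊆C : ∀ {c} → c ∈ T → c ∈ reflectSet l A
    T⊆C c∈ with ∈T c∈
    ... | a , a∈ , _ , refl = ∈-map⁺ (l ∸_) (proj₂ (proj₂ (∈middle a∈)))

    1≤T : ∀ {c} → c ∈ T → 1 ≤ c
    1≤T c∈ with ∈T c∈
    ... | a , a∈ , _ , refl = m<n⇒0<n∸m (proj₁ (proj₂ (∈middle a∈)))

    T≤L : ∀ {c} → c ∈ T → c ≤ L
    T≤L c∈ with ∈T c∈
    ... | a , a∈ , _ , refl = ∸-monoʳ-≤ l (proj₁ (∈middle a∈))

    n≤3+N : length A ≤ 3 + length T
    n≤3+N = ≤-trans n≤3+∣middle∣ (≤-reflexive (cong (3 +_) (sym (length-map (l ∸_) middle))))

    N≤L : length T ≤ L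
    N≤L = ≤-pred (unique-bounded (All.tabulate (λ { c∈ refl → <⇒≱ (1≤T c∈) z≤n }) ∷ uT) λ { (here refl) → s≤s z≤n ; (there c∈) → s≤s (T≤L c∈) })

    -- At most 0, 1 and `l` are lost in passing from A to T, and with l = L + m + 2 the first bound
    -- on m is exactly 3(n-3) ≥ 2L + 4.
    dense : 2 * L + 4 ≤ 3 * length T
    dense = combine (length A) (length T) L L+m+2≡l n≤3+N 2m+3n
      where
      combine : ∀ n N L → L + (m + 2) ≡ l → n ≤ 3 + N → 2 * l + 9 ≤ 2 * m + 3 * n → 2 * L + 4 ≤ 3 * N
      combine n N L h₁ h₂ h₃ = by≤ (2 ⊗ (≤-reflexive h₁) ⊕ 3 ⊗ h₂ ⊕ h₃) 0 (solve (L ▹ m ▹ l ▹ n ▹ N ▹ □))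

    1≤m : 1 ≤ m
    1≤m = n≢0⇒n>0 λ m≡0 → contra (length A) (unique-bounded uA (λ a∈ → s≤s (A≤l a∈)))
                             (subst (λ m → 2 * l + 4 ≤ 3 * m + 2 * length A) m≡0 3m+2n)
      where
      contra : ∀ n → n ≤ suc l → 2 * l + 4 ≤ 3 * 0 + 2 * n → ⊥
      contra n h₁ h₂ = by⊥ (2 ⊗ h₁ ⊕ h₂) 1 (solve (n ▹ l ▹ □))

    N+1+m≤m*l : length T + suc m ≤ m * l
    N+1+m≤m*l = combine (length T) N≤L L+m+2≡l (scale l 1≤m)
      where
      combine : ∀ N {L} → N ≤ L → L + (m + 2) ≡ l → 1 * l ≤ m * l → N + suc m ≤ m * l
      combine N {L} h₁ h₂ h₃ = by≤ (h₁ ⊕ ≤-reflexive h₂ ⊕ h₃) 1 (solve (N ▹ L ▹ m ▹ l ▹ □))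

  1+m≤m*l : suc m ≤ m * l
  1+m≤m*l = ≤-trans (m≤n+m (suc m) (length T)) N+1+m≤m*l

  co-representable : Representable (reflectSet l A) (m * l ∸ suc m)
  co-representable = Dense.representable (reflectSet l A) T L uT T⊆C 1≤T T≤L dense (m * l ∸ suc m)
    (m+n≤o⇒m≤o∸n (length T) N+1+m≤m*l)

-- Reduction to a maximal exception

≤-maxList : ∀ {A a} → a ∈ A → a ≤ maxList A
≤-maxList {a ∷ A} (here refl) = m≤m⊔n a (maxList A)
≤-maxList {b ∷ A} (there a∈) = ≤-trans (≤-maxList a∈) (m≤n⊔m b (maxList A))

maxList-∈ : ∀ {A} → 0 ∈ A → maxList A ∈ A
maxList-∈ {A} 0∈A with attained A
  where
  attained : ∀ A → maxList A ∈ 0 ∷ A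
  attained [] = here refl
  attained (a ∷ A) with ⊔-sel a (maxList A)
  ... | inj₁ eq = there (here eq)
  ... | inj₂ eq with attained A
  ...   | here eq′ = here (trans eq eq′)
  ...   | there max∈ = there (there (subst (_∈ A) (sym eq) max∈))
... | here eq = subst (_∈ A) (sym eq) 0∈A
... | there max∈ = max∈

first-true : (Q : ℕ → Set) → (∀ n → Dec (Q n)) → ¬ Q 0 → ∀ N → Q N → ∃ λ n → ¬ Q n × Q (suc n)
first-true Q Q? ¬Q0 zero q = ⊥-elim (¬Q0 q)
first-true Q Q? ¬Q0 (suc N) q with Q? N
... | yes q′ = first-true Q Q? ¬Q0 N q′
... | no ¬q = N , ¬q , q

module Reflection (A : List ℕ) (l : ℕ) (A≤l : ∀ {a} → a ∈ A → a ≤ l) where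

  sumset-reflect : ∀ {k v} → InSumset A k v → ∃ λ u → InSumset (reflectSet l A) k u × u + v ≡ k * l
  sumset-reflect sum-zero = 0 , sum-zero , refl
  sumset-reflect (sum-suc {a = a} {x} a∈ s) with sumset-reflect s
  ... | u , s′ , eq = l ∸ a + u , sum-suc (∈-map⁺ (l ∸_) a∈) s′ , regroup (m∸n+n≡m (A≤l a∈)) eq
    where
    regroup : ∀ {b w} → b + a ≡ l → u + x ≡ w → b + u + (a + x) ≡ l + w
    regroup {b} {w} h₁ h₂ = by≡ (h₁ ⊞ h₂) (solve (b ▹ a ▹ l ▹ u ▹ x ▹ w ▹ □))

  representable-reflect : ∀ {z} → Representable (reflectSet l A) z → ∃₂ λ k u → InSumset A k u × u + z ≡ k * l
  representable-reflect rep-zero = 0 , 0 , sum-zero , refl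
  representable-reflect (rep-add {x = x} c∈ r) with representable-reflect r | ∈-map⁻ (l ∸_) c∈
  ... | k , u , s , eq | a , a∈ , refl = suc k , a + u , sum-suc a∈ s , regroup (m∸n+n≡m (A≤l a∈)) eq
    where
    regroup : ∀ {b w} → b + a ≡ l → u + x ≡ w → a + u + (b + x) ≡ l + w
    regroup {b} {w} h₁ h₂ = by≡ (h₁ ⊞ h₂) (solve (b ▹ a ▹ l ▹ u ▹ x ▹ w ▹ □))

  reflect-involutive : ∀ {a} → a ∈ reflectSet l (reflectSet l A) → a ∈ A
  reflect-involutive a∈ with ∈-map⁻ (l ∸_) a∈
  ... | c , c∈ , refl with ∈-map⁻ (l ∸_) c∈
  ...   | a , a∈A , refl = subst (_∈ A) (sym (m∸[m∸n]≡n (A≤l a∈A))) a∈A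

Representable-⊆ : ∀ {B C z} → (∀ {b} → b ∈ B → b ∈ C) → Representable B z → Representable C z
Representable-⊆ B⊆C rep-zero = rep-zero
Representable-⊆ B⊆C (rep-add b∈ r) = rep-add (B⊆C b∈) (Representable-⊆ B⊆C r)

¬Exceptional⇒¬¬Representable : ∀ {B z} → ¬ Exceptional B z → ¬ ¬ Representable B z
¬Exceptional⇒¬¬Representable {z = zero} _ ¬r = ¬r rep-zero
¬Exceptional⇒¬¬Representable {z = suc z} ¬ex ¬r = ¬ex (s≤s z≤n , ¬r)

Representable⇒¬Exceptional : ∀ {B z} → Representable B z → ¬ Exceptional B z
Representable⇒¬Exceptional r (_ , ¬r) = ¬r r

module Structure (A : List ℕ) (uA : Unique A) (gcd≡1 : gcdList A ≡ 1) (l : ℕ) .{{_ : NonZero l}}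
  (0∈A : 0 ∈ A) (l∈A : l ∈ A) (A≤l : ∀ {a} → a ∈ A → a ≤ l) where

  open Sumset A l 0∈A l∈A A≤l
  open LongMinimal A uA l 0∈A l∈A A≤l
  open Gap A uA gcd≡1 l 0∈A l∈A A≤l

  -- The result is irreducible only against removing a single `l`; it becomes a minimal point in
  -- `corner-exceptional`, where (m , x) is missing.
  strip-l : ∀ {K V} → S K V → ∃₂ λ k v → ∃ λ j → S k v × v + j * l ≡ V × k + j ≡ K ×
    (∀ {k′ v′} → suc k′ ≡ k → v′ + l ≡ v → ¬ S k′ v′)
  strip-l {zero} s = _ , _ , 0 , s , +-identityʳ _ , refl , λ ()
  strip-l {suc K} {V} s with (l ≤? V) ×-dec S? K (V ∸ l)
  ... | no irreducible = _ , V , 0 , s , +-identityʳ V , +-identityʳ (suc K) ,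
        λ { {v′ = v′} refl eq s′ → irreducible (≤-trans (m≤n+m l v′) (≤-reflexive eq) ,
              subst (S K) (trans (sym (m+n∸n≡m v′ l)) (cong (_∸ l) eq)) s′) }
  ... | yes (l≤V , s′) with strip-l s′
  ...   | k , v , j , s₀ , eq , eq′ , irreducible = k , v , suc j , s₀ ,
        regroup (m∸n+n≡m l≤V) eq , trans (+-suc k j) (cong suc eq′) , irreducible
    where
    regroup : ∀ {U} → U + l ≡ V → v + j * l ≡ U → v + suc j * l ≡ V
    regroup {U} h₁ h₂ = by≡ (h₁ ⊞ h₂) (solve (U ▹ l ▹ V ▹ v ▹ j ▹ □))

  strip-0 : ∀ {K V} → S K V → ∃₂ λ k i → S k V × k + i ≡ K × (∀ {k′} → suc k′ ≡ k → ¬ S k′ V)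
  strip-0 {zero} s = _ , 0 , s , refl , λ ()
  strip-0 {suc K} {V} s with S? K V
  ... | no irreducible = suc K , 0 , s , +-identityʳ (suc K) , λ { refl → irreducible }
  ... | yes s′ with strip-0 s′
  ...   | k , i , s₀ , eq , irreducible = k , suc i , s₀ , trans (+-suc k i) (cong suc eq) , irreducible

  C₁-mono : ∀ {m m′} → m ≤ m′ → C₁ m′ → C₁ m
  C₁-mono m≤ (1∈ , h) = 1∈ , λ a a∈ → [ inj₁ , (λ (lo , hi) → inj₂ (≤-trans (+-monoˡ-≤ 2 m≤) lo , hi)) ]′ (h a a∈)

  C₂-mono : ∀ {m m′} → m ≤ m′ → C₂ m′ → C₂ m
  C₂-mono m≤ (l-1∈ , l∈ , h) = l-1∈ , l∈ , λ a a∈ → [ (λ lo → inj₁ (≤-trans (+-monoʳ-≤ a (+-monoˡ-≤ 2 m≤)) lo)) , inj₂ ]′ (h a a∈)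

  module _ {m x : ℕ} (missing : ¬ S m x) (right : S (suc m) x) (up : S (suc m) (x + l))
    (2m+3n : 2 * l + 9 ≤ 2 * m + 3 * length A) (3m+2n : 2 * l + 4 ≤ 3 * m + 2 * length A) where

    corner-exceptional : C₁ m ⊎ C₂ m
    corner-exceptional with strip-l right | strip-0 up
    ... | k₀ , v₀ , j , s₀ , value₀ , size₀ , irreducible₀ | k₁ , i , s₁ , size₁ , irreducible₁ = cases j i value₀ size₀ size₁
      where
      -- A shorter origin with a zero to spare would reach (m , x) once the j copies of `l` are put
      -- back; without a spare zero it uses some `l`, against `irreducible₀`.
      min₀ : Minimal k₀ v₀
      min₀ {k} {v} Y s h₁ h₂ h₃ with suc (k + Y) ≤? k₀
      ... | yes h = missing (S-up (Y + j) s value size)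
        where
        value : v + (Y + j) * l ≡ x
        value = by≡ (h₁ ⊞ value₀) (solve (v ▹ Y ▹ l ▹ v₀ ▹ j ▹ x ▹ □))
        size : k + (Y + j) ≤ m
        size = by≤ (h ⊕ ≤-reflexive size₀) 0 (solve (k ▹ Y ▹ k₀ ▹ j ▹ m ▹ □))
      min₀ {k} {v} zero s h₁ h₂ h₃ | no h = h (≤-trans (s≤s (≤-reflexive (+-identityʳ k))) h₃)
      min₀ {k} {v} (suc Y) s h₁ h₂ h₃ | no h = irreducible₀ {k + Y} {v + Y * l} (≤-antisym
          (≤-trans (≤-reflexive (sym (+-suc k Y))) h₂) (≤-trans (≤-pred (≰⇒> h)) (≤-reflexive (+-suc k Y)))) value (S-up Y s refl ≤-refl)
        where
        value : v + Y * l + l ≡ v₀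
        value = by≡ h₁ (solve (v ▹ Y ▹ l ▹ v₀ ▹ □))
      -- Zeros and copies of `l` exchange roles: an origin that uses some `l` reaches (m , x) by
      -- dropping it, and one without contradicts `irreducible₁`.
      min₁ : Minimal k₁ (x + l)
      min₁ {k} zero s h₁ h₂ h₃ = irreducible₁ (m+[n∸m]≡n {1} (≤-trans (s≤s z≤n) h₃))
        (S-up 0 s h₁ (≤-trans (≤-reflexive (+-identityʳ k)) (≤-pred (≤-trans h₃ (≤-reflexive (sym (m+[n∸m]≡n {1} (≤-trans (s≤s z≤n) h₃))))))))
      min₁ {k} {v} (suc Y) s h₁ h₂ h₃ = missing (S-up Y s value size)
        where
        value : v + Y * l ≡ x
        value = by≡ h₁ (solve (v ▹ Y ▹ l ▹ x ▹ □))
        size : k + Y ≤ m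
        size = by≤ (h₂ ⊕ ≤-reflexive size₁) i (solve (k ▹ Y ▹ k₁ ▹ i ▹ m ▹ □))
      cases : ∀ j i → v₀ + j * l ≡ x → k₀ + j ≡ suc m → k₁ + i ≡ suc m → C₁ m ⊎ C₂ m
      -- If nothing was stripped, the minimal point still has 1+m summands.
      cases zero _ _ e _ = long-minimal m 2m+3n 3m+2n (subst (λ k → S k v₀) e′ s₀) (subst (λ k → Minimal k v₀) e′ min₀)
        where e′ = trans (sym (+-identityʳ k₀)) e
      cases (suc _) zero _ _ e = long-minimal m 2m+3n 3m+2n (subst (λ k → S k (x + l)) e′ s₁) (subst (λ k → Minimal k (x + l)) e′ min₁)
        where e′ = trans (sym (+-identityʳ k₁)) e
      cases (suc j) (suc i) e₁ e₂ e₃ = ⊥-elim (Corner.contradiction missing s₀ min₀ e₁ e₂ s₁ min₁ refl e₃ (s≤s z≤n) (s≤s z≤n) 2m+3n)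

  module _ {m x : ℕ} (missing : ¬ S m x) (x≤ : x ≤ m * l)
    (2m+3n : 2 * l + 9 ≤ 2 * m + 3 * length A) (3m+2n : 2 * l + 4 ≤ 3 * m + 2 * length A) where

    -- Adding zeros, one stops just before entering `S`; then, adding copies of `l`, one stops again
    -- just before entering it. The neighbour in the first direction stays in `S` meanwhile, so this
    -- is a corner. Its size is m + p + q, for which both bounds persist, and `C₁-mono` and
    -- `C₂-mono` carry the conclusion back to m.
    gap-exceptional : Representable A x → Representable (reflectSet l A) (m * l ∸ x) → C₁ m ⊎ C₂ m
    gap-exceptional rep rep′ with Rep⇒S rep | Reflection.representable-reflect A l A≤l rep′
    ... | k , s | k′ , u , s′ , eq
      with first-true (λ p → S (p + m) x) (λ p → S? (p + m) x) missing k
             (S-up 0 s (+-identityʳ x) (≤-trans (≤-reflexive (+-identityʳ k)) (m≤m+n k m)))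
    ...   | p , ¬p , right
      with first-true (λ q → S (q + (p + m)) (q * l + x)) (λ q → S? (q + (p + m)) (q * l + x)) ¬p k′
             -- The second search ends because u + (m*l - x) = k′*l: adding k′ copies of `l` to x
             -- gives the same value as adding m copies to u.
             (S-up m s′ (value eq (m∸n+n≡m x≤)) (+-monoʳ-≤ k′ (m≤n+m m p)))
      where
      value : ∀ {z w} → u + z ≡ k′ * l → z + x ≡ w → u + w ≡ k′ * l + x
      value {z} {w} h₁ h₂ = by≡ (h₁ ⊞ (sym h₂)) (solve (u ▹ z ▹ k′ ▹ l ▹ x ▹ w ▹ □))
    ...     | q , ¬q , up = [ inj₁ ∘ C₁-mono m≤ , inj₂ ∘ C₂-mono m≤ ]′
              (corner-exceptional ¬q (subst (λ k → S k (q * l + x)) (+-suc q (p + m)) (S-ls q right))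
                (subst (S _) (rotate (q * l) x) up)
                (≤-trans 2m+3n (+-monoˡ-≤ (3 * length A) (*-monoʳ-≤ 2 m≤))) (≤-trans 3m+2n (+-monoˡ-≤ (2 * length A) (*-monoʳ-≤ 3 m≤))))
      where
      m≤ : m ≤ q + (p + m)
      m≤ = ≤-trans (m≤n+m m p) (m≤n+m (p + m) q)
      rotate : ∀ a x → l + a + x ≡ a + x + l
      rotate a x = solve (l ▹ a ▹ x ▹ □)

theorem4 : (A : List ℕ) → Unique A → 6 ≤ length A → 0 ∈ A → gcdList A ≡ 1 →
    (m : ℕ) →
    2 * maxList A + 9 ≤ 2 * m + 3 * length A →
    2 * maxList A + 4 ≤ 3 * m + 2 * length A →
    let l = maxList A
        Eq = ∀ (x : ℕ) → InSumset A m x ⇔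
               ((x ≤ m * l) × ¬ Exceptional A x × ¬ Exceptional (reflectSet l A) (m * l ∸ x))
        C1 = (1 ∈ A) × (∀ a → a ∈ A → (a ≤ 1) ⊎ ((m + 2 ≤ a) × (a ≤ l)))
        C2 = ((l ∸ 1) ∈ A) × (l ∈ A) × (∀ a → a ∈ A → (a + (m + 2) ≤ l) ⊎ ((a ≡ l ∸ 1) ⊎ (a ≡ l)))
    in ((¬ C1 × ¬ C2) → Eq) × ((C1 ⊎ C2) → ¬ Eq)
theorem4 A uA 6≤n 0∈A gcd≡1 m 2m+3n 3m+2n = equality , [ C₁⇒≢ , C₂⇒≢ ]′
  where
  l = maxList A
  l∈A : l ∈ A
  l∈A = maxList-∈ 0∈A
  A≤l : ∀ {a} → a ∈ A → a ≤ l
  A≤l = ≤-maxList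
  instance
    l≢0 : NonZero l
    l≢0 = >-nonZero (≤-trans (s≤s z≤n) (≤-pred (≤-trans 6≤n (unique-bounded uA (s≤s ∘ A≤l)))))
  B = reflectSet l A
  open Sumset A l 0∈A l∈A A≤l
  open LongMinimal A uA l 0∈A l∈A A≤l using (C₁; C₂)
  module R = Reflection A l A≤l

  Equal : Set
  Equal = ∀ x → InSumset A m x ⇔ ((x ≤ m * l) × ¬ Exceptional A x × ¬ Exceptional B (m * l ∸ x))

  reflected : ∀ {x} → S m x → InSumset B m (m * l ∸ x)
  reflected {x} s with R.sumset-reflect s
  ... | u , s′ , eq = subst (InSumset B m) (trans (sym (m+n∸n≡m u x)) (cong (_∸ x) eq)) s′

  B-representable : ∀ {k v} → InSumset B k v → Representable B v
  B-representable sum-zero = rep-zero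
  B-representable (sum-suc b∈ s) = rep-add b∈ (B-representable s)

  equality : ¬ C₁ m × ¬ C₂ m → Equal
  equality (¬C₁ , ¬C₂) x = mk⇔
    (λ s → S-≤ s , Representable⇒¬Exceptional (S⇒Rep s) , Representable⇒¬Exceptional (B-representable (reflected s)))
    (λ (x≤ , ¬ex , ¬ex′) → decidable-stable (S? m x) λ missing →
      ¬Exceptional⇒¬¬Representable ¬ex λ rep → ¬Exceptional⇒¬¬Representable ¬ex′ λ rep′ →
        [ ¬C₁ , ¬C₂ ]′ (Structure.gap-exceptional A uA gcd≡1 l 0∈A l∈A A≤l missing x≤ 2m+3n 3m+2n rep rep′))

  ones : ∀ {C} → 1 ∈ C → ∀ k → Representable C k
  ones 1∈ zero = rep-zero
  ones 1∈ (suc k) = rep-add 1∈ (ones 1∈ k)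

  -- The witness is 1+m: a sum of ones whose reflection is representable, yet not an m-fold sum.
  C₁⇒≢ : C₁ m → ¬ Equal
  C₁⇒≢ (1∈A , dichotomy) eq = O.1+m∉mA (Equivalence.from (eq (suc m))
      (O.1+m≤m*l , Representable⇒¬Exceptional (ones 1∈A (suc m)) , Representable⇒¬Exceptional O.co-representable))
    where module O = Obstruction A uA l A≤l 6≤n m 2m+3n 3m+2n dichotomy

  -- The reflection a ↦ l - a exchanges the two families and the two exceptional sets, so the
  -- witness is m*l - (1+m).
  C₂⇒≢ : C₂ m → ¬ Equal
  C₂⇒≢ (l-1∈A , _ , dichotomy) eq = O.1+m∉mA (subst (InSumset B m) (m∸[m∸n]≡n O.1+m≤m*l) (reflected (Equivalence.from (eq (m * l ∸ suc m))
      (m∸n≤m (m * l) (suc m) ,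
       Representable⇒¬Exceptional (Representable-⊆ R.reflect-involutive O.co-representable) ,
       Representable⇒¬Exceptional (subst (Representable B) (sym (m∸[m∸n]≡n O.1+m≤m*l)) (ones 1∈B (suc m)))))))
    where
    1∈B : 1 ∈ B
    1∈B = subst (_∈ B) (m∸[m∸n]≡n (>-nonZero⁻¹ l)) (∈-map⁺ (l ∸_) l-1∈A)
    B≤l : ∀ {b} → b ∈ B → b ≤ l
    B≤l b∈ with ∈-map⁻ (l ∸_) b∈
    ... | a , _ , refl = m∸n≤m l a
    dichotomy′ : ∀ b → b ∈ B → (b ≤ 1) ⊎ ((m + 2 ≤ b) × (b ≤ l))
    dichotomy′ b b∈ with ∈-map⁻ (l ∸_) b∈
    ... | a , a∈ , refl with dichotomy a a∈
    ...   | inj₁ h = inj₂ (m+n≤o⇒m≤o∸n (m + 2) (≤-trans (≤-reflexive (+-comm (m + 2) a)) h) , m∸n≤m l a)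
    ...   | inj₂ (inj₁ a≡) = inj₁ (≤-reflexive (trans (cong (l ∸_) a≡) (m∸[m∸n]≡n (>-nonZero⁻¹ l))))
    ...   | inj₂ (inj₂ a≡) = inj₁ (≤-trans (≤-reflexive (trans (cong (l ∸_) a≡) (n∸n≡0 l))) z≤n)
    uB : Unique B
    uB = map-unique (λ a∈ b∈ → ∸-cancelˡ-≡ (A≤l a∈) (A≤l b∈)) uA
    6≤∣B∣ : 6 ≤ length B
    6≤∣B∣ = subst (6 ≤_) (sym (length-map (l ∸_) A)) 6≤n
    module O = Obstruction B uB l B≤l 6≤∣B∣ m
      (subst (λ n → 2 * l + 9 ≤ 2 * m + 3 * n) (sym (length-map (l ∸_) A)) 2m+3n)
      (subst (λ n → 2 * l + 4 ≤ 3 * m + 2 * n) (sym (length-map (l ∸_) A)) 3m+2n) dichotomy′
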